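{- Let $q$ be a prime power, let $d \geq k \geq 4$ be fixed integers, and let $n$ be sufficiently large. Suppose $\mathcal{V}$ is a family of $k$-dimensional subspaces of $\mathbb{F}_q^n$ with no non-trivial intersecting subfamily of size $d+1$. Then \[|\mathcal{V}| \leq q^{n-k}\genfrac{[}{]}{0pt}{}{n-1}{k-1} = \genfrac{[}{]}{0pt}{}{n}{k} - \genfrac{[}{]}{0pt}{}{n-1}{k}.\]
   Context: $\genfrac{[}{]}{0pt}{}{n}{k} = \prod_{0 \leq i \leq k-1}\frac{q^{n-i}-1}{q^{k-i}-1}$. A family of subspaces is intersecting if any two distinct members have intersection of positive dimension; it is non-trivial intersecting if it is intersecting and the intersection of all its members is the zero subspace. -}

module Defs where

open import Level using (0ℓ)
open import Data.Nat using (ℕ; zero; suc; _∸_; _^_)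
import Data.Nat as ℕ
open import Data.Nat.DivMod using (_/_)
open import Data.Fin using (Fin) renaming (zero to fz; suc to fs)
open import Data.Vec using (Vec; replicate; zipWith; map)
open import Data.List using (List; length; lookup)
open import Data.Bool using (Bool; true)
open import Data.Product using (Σ; ∃; _×_)
open import Relation.Binary.PropositionalEquality using (_≡_; _≢_)
open import Relation.Nullary using (¬_)
open import Function.Bundles using (_↔_; _⇔_)
open import Function.Definitions using (Injective)
open import Algebra.Structures using (IsCommutativeRing)

-- Finite fields.  A finite field of order q is a field (with
-- propositional equality) whose carrier is in bijection with Fin q.
-- Finite fields exist exactly for prime powers q, and F_q is unique up
-- to isomorphism, so quantifying over all finite fields F with q = card F
-- is "for every prime power q, over F_q".

record FiniteField : Set₁ where
  infixl 6 _+_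
  infixl 7 _*_
  field
    Carrier : Set
    _+_ _*_ : Carrier → Carrier → Carrier
    -_      : Carrier → Carrier
    0# 1#   : Carrier
    isCommutativeRing : IsCommutativeRing _≡_ _+_ _*_ -_ 0# 1#
    1≢0     : 1# ≢ 0#
    inverse : ∀ x → x ≢ 0# → Σ Carrier (λ y → x * y ≡ 1#)
    card    : ℕ
    enum    : Carrier ↔ Fin card

module _ (F : FiniteField) where
  open FiniteField F

  zeroVec : ∀ {n} → Vec Carrier n
  zeroVec = replicate _ 0#

  _⊕_ : ∀ {n} → Vec Carrier n → Vec Carrier n → Vec Carrier n
  _⊕_ = zipWith _+_

  _⊙_ : ∀ {n} → Carrier → Vec Carrier n → Vec Carrier n
  c ⊙ v = map (c *_) v

  lincomb : ∀ {n k} → (Fin k → Carrier) → (Fin k → Vec Carrier n) → Vec Carrier n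
  lincomb {k = zero}  c b = zeroVec
  lincomb {k = suc k} c b = (c fz ⊙ b fz) ⊕ lincomb (λ i → c (fs i)) (λ i → b (fs i))

  LinIndep : ∀ {n k} → (Fin k → Vec Carrier n) → Set
  LinIndep b = ∀ c → lincomb c b ≡ zeroVec → ∀ i → c i ≡ 0#

  record Subspace (n k : ℕ) : Set where
    field
      mem   : Vec Carrier n → Bool
      basis : Fin k → Vec Carrier n
      indep : LinIndep basis
      spans : ∀ v → (mem v ≡ true) ⇔ (∃ λ c → lincomb c basis ≡ v)
  open Subspace public

  SameSubspace : ∀ {n k} → Subspace n k → Subspace n k → Set
  SameSubspace U W = ∀ v → mem U v ≡ mem W v

  -- A family (finite set) of k-subspaces: a list of pairwise distinct ones.
  Distinct : ∀ {n k} → List (Subspace n k) → Set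
  Distinct 𝒱 = ∀ i j → i ≢ j → ¬ SameSubspace (lookup 𝒱 i) (lookup 𝒱 j)

  PosIntersect : ∀ {n k} → Subspace n k → Subspace n k → Set
  PosIntersect U W = ∃ λ v → v ≢ zeroVec × mem U v ≡ true × mem W v ≡ true

  HasNonTrivIntSubfamily : ∀ {n k} → List (Subspace n k) → ℕ → Set
  HasNonTrivIntSubfamily 𝒱 m =
    Σ (Fin m → Fin (length 𝒱)) λ f →
      Injective _≡_ _≡_ f
      × (∀ i j → i ≢ j → PosIntersect (lookup 𝒱 (f i)) (lookup 𝒱 (f j)))
      × (∀ v → (∀ i → mem (lookup 𝒱 (f i)) v ≡ true) → v ≡ zeroVec)

-- Gaussian binomial coefficient, via the product formula
--   [n k]_q = ∏_{0≤i≤k-1} (q^{n-i} - 1) / (q^{k-i} - 1).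
-- (The quotient of the two products is exact; division by 0 returns 0,
-- which never happens for q ≥ 2.)

prodUpTo : ℕ → (ℕ → ℕ) → ℕ
prodUpTo zero    f = 1
prodUpTo (suc k) f = prodUpTo k f ℕ.* f k

_/′_ : ℕ → ℕ → ℕ
m /′ zero  = 0
m /′ suc d = m / suc d

gauss : ℕ → ℕ → ℕ → ℕ
gauss q n k =
  prodUpTo k (λ i → q ^ (n ∸ i) ∸ 1) /′ prodUpTo k (λ i → q ^ (k ∸ i) ∸ 1)

{-# OPTIONS --safe #-}
-- Write k = 2 + m and Q = q^n.  The bound is a fraction of about 1 − q^(-k) ≥ 15/16 of all k-subspaces,
-- so if it is exceeded, at least 3/4 of the Q^k k-tuples of vectors are bases of members (distinct members
-- have distinct bases, which lets one count bases in place of subspaces).  Choose vectors x, y, z and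
-- m-tuples t, s, r uniformly.  By the union bound, with positive probability
--   * (x,y,t), (y,z,s), (x,z,r) are bases of members W₁, W₂, W₃,
--   * more than d members contain both x and y (the bases of members extending any other pair (x,y)
--     number at most d q^(km), a vanishing fraction of Q^m),
--   * (x,y,z,t,s) and (x,y,z,r) are linearly independent.
-- Then W₁ ∩ W₂ = ⟨y⟩ and y ∉ W₃, so W₁, W₂, W₃ meet trivially.  Together with further members through
-- x and y they intersect pairwise in x, y or z, and this gives a non-trivial intersecting family of size d + 1.
module Submission where

open import Defs
open import Data.Nat using (ℕ; _≤_; _^_; _∸_; _*_; _+_; zero; suc; _<_; z≤n; s≤s; NonZero; z<s; >-nonZero)
open import Data.Nat.Properties hiding (_≟_)
open import Data.Nat.DivMod using (_/_; _%_; m≡m%n+[m/n]*n; m%n<n)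
open import Data.Nat.Tactic.RingSolver using (solve-∀)
open import Data.Bool using (Bool; true; false)
open import Data.Bool.Properties using () renaming (_≟_ to _≟ᵇ_)
open import Data.Fin using (Fin; inject≤) renaming (zero to fz; suc to fs)
open import Data.Fin.Properties using (inject≤-injective) renaming (_≟_ to _≟ᶠ_)
open import Data.List using (List; []; _∷_; length; lookup; allFin; cartesianProductWith; filter; tabulate)
open import Data.List.Properties using (length-tabulate; length-map)
open import Data.List.Relation.Unary.Unique.Propositional using (Unique; []; _∷_)
open import Data.List.Relation.Unary.Unique.Propositional.Properties using (allFin⁺; filter⁺)
import Data.List as L
import Data.List.Relation.Unary.All as LAll
open import Data.List.Relation.Unary.All.Properties using (all-filter)
open import Data.List.Membership.Propositional.Properties using (∈-lookup)
open import Data.Vec using (Vec; []; _∷_; _++_) renaming (lookup to vlookup; tabulate to vtabulate)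
open import Data.Vec.Properties using (≡-dec; zipWith-assoc; zipWith-comm; zipWith-identityˡ; zipWith-identityʳ;
  ∷-injective; ++-injectiveˡ; tabulate∘lookup)
open import Data.Vec.Relation.Unary.All using (All; []; _∷_; all?)
open import Algebra.Structures using (IsCommutativeRing)
open import Data.Product using (∃; _×_; _,_; proj₁; proj₂)
open import Data.Sum using (_⊎_; inj₁; inj₂)
open import Data.Empty using (⊥-elim)
open import Data.Unit using (⊤; tt)
open import Function using (_∘_; _$_)
open import Function.Bundles using (Inverse; Equivalence)
open import Relation.Nullary using (¬_; Dec; yes; no; does)
open import Relation.Nullary.Decidable using (_×-dec_; ¬?; map′)
open import Relation.Nullary.Negation using (contradiction)
open import Relation.Binary.PropositionalEquality
open import Relation.Binary.Definitions using (DecidableEquality)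

-- Finite sums over lists.

∑ : {A : Set} → List A → (A → ℕ) → ℕ
∑ []       f = 0
∑ (x ∷ xs) f = f x + ∑ xs f

module _ {A : Set} where

  ∑-mono : (xs : List A) {f g : A → ℕ} → (∀ x → f x ≤ g x) → ∑ xs f ≤ ∑ xs g
  ∑-mono []       h = z≤n
  ∑-mono (x ∷ xs) h = +-mono-≤ (h x) (∑-mono xs h)

  ∑-cong : (xs : List A) {f g : A → ℕ} → (∀ x → f x ≡ g x) → ∑ xs f ≡ ∑ xs g
  ∑-cong []       h = refl
  ∑-cong (x ∷ xs) h = cong₂ _+_ (h x) (∑-cong xs h)

  ∑-+ : (xs : List A) (f g : A → ℕ) → ∑ xs (λ x → f x + g x) ≡ ∑ xs f + ∑ xs g
  ∑-+ []       f g = refl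
  ∑-+ (x ∷ xs) f g = begin
    f x + g x + ∑ xs (λ y → f y + g y)   ≡⟨ cong (f x + g x +_) (∑-+ xs f g) ⟩
    f x + g x + (∑ xs f + ∑ xs g)        ≡⟨ interchange (f x) (g x) (∑ xs f) (∑ xs g) ⟩
    f x + ∑ xs f + (g x + ∑ xs g)        ∎
    where
    open ≡-Reasoning
    interchange : ∀ a b c d → a + b + (c + d) ≡ a + c + (b + d)
    interchange = solve-∀

  ∑-*ˡ : (xs : List A) (c : ℕ) (f : A → ℕ) → ∑ xs (λ x → c * f x) ≡ c * ∑ xs f
  ∑-*ˡ []       c f = sym (*-zeroʳ c)
  ∑-*ˡ (x ∷ xs) c f =
    trans (cong (c * f x +_) (∑-*ˡ xs c f)) (sym (*-distribˡ-+ c (f x) (∑ xs f)))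

  ∑-const : (xs : List A) (c : ℕ) → ∑ xs (λ _ → c) ≡ length xs * c
  ∑-const []       c = refl
  ∑-const (x ∷ xs) c = cong (c +_) (∑-const xs c)

  ∑-≤ : (xs : List A) {f : A → ℕ} {c : ℕ} → (∀ x → f x ≤ c) → ∑ xs f ≤ length xs * c
  ∑-≤ xs {c = c} h = ≤-trans (∑-mono xs h) (≤-reflexive (∑-const xs c))

  ∑-≥ : (xs : List A) {f : A → ℕ} {c : ℕ} → (∀ x → c ≤ f x) → length xs * c ≤ ∑ xs f
  ∑-≥ xs {c = c} h = ≤-trans (≤-reflexive (sym (∑-const xs c))) (∑-mono xs h)

  -- First-moment principle, proved by search: a term with `f x ≥ g x` can be discarded without
  -- spoiling the strict inequality between the remaining sums, and empty sums cannot satisfy one.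
  ∑-< : (xs : List A) (f g : A → ℕ) → ∑ xs f < ∑ xs g → ∃ λ x → f x < g x
  ∑-< []       f g ()
  ∑-< (x ∷ xs) f g p with f x <? g x
  ... | yes q = x , q
  ... | no ¬q = ∑-< xs f g (≰⇒> λ r → <⇒≱ p (+-mono-≤ (≮⇒≥ ¬q) r))

  ∑-positive : (xs : List A) (f : A → ℕ) → 0 < ∑ xs f → ∃ λ x → 0 < f x
  ∑-positive xs f p =
    ∑-< xs (λ _ → 0) f (subst (_< ∑ xs f) (sym (trans (∑-const xs 0) (*-zeroʳ (length xs)))) p)

∑-swap : {A B : Set} (xs : List A) (ys : List B) (f : A → B → ℕ) →
         ∑ xs (λ x → ∑ ys (f x)) ≡ ∑ ys (λ y → ∑ xs (λ x → f x y))
∑-swap []       ys f = sym (trans (∑-const ys 0) (*-zeroʳ (length ys)))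
∑-swap (x ∷ xs) ys f =
  trans (cong (∑ ys (f x) +_) (∑-swap xs ys f)) (sym (∑-+ ys (f x) _))

∑-++ : {A : Set} (xs ys : List A) (f : A → ℕ) → ∑ (xs L.++ ys) f ≡ ∑ xs f + ∑ ys f
∑-++ []       ys f = refl
∑-++ (x ∷ xs) ys f = trans (cong (f x +_) (∑-++ xs ys f)) (sym (+-assoc (f x) _ _))

∑-map : {A B : Set} (g : A → B) (xs : List A) (f : B → ℕ) → ∑ (L.map g xs) f ≡ ∑ xs (f ∘ g)
∑-map g []       f = refl
∑-map g (x ∷ xs) f = cong (f (g x) +_) (∑-map g xs f)

∑-product : {A B C : Set} (_∙_ : A → B → C) (xs : List A) (ys : List B) (f : C → ℕ) →
            ∑ (cartesianProductWith _∙_ xs ys) f ≡ ∑ xs (λ x → ∑ ys (λ y → f (x ∙ y)))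
∑-product _∙_ []       ys f = refl
∑-product _∙_ (x ∷ xs) ys f =
  trans (∑-++ (L.map (x ∙_) ys) _ f)
        (cong₂ _+_ (∑-map (x ∙_) ys f) (∑-product _∙_ xs ys f))

-- Indicators of decidable propositions.

ι : Bool → ℕ
ι true  = 1
ι false = 0

-- Only `does` enters, so indicators of decisions built with `map′` or `×-dec` reduce
-- definitionally.
χ : {P : Set} → Dec P → ℕ
χ d = ι (does d)

module _ {P : Set} where

  χ≤1 : (d : Dec P) → χ d ≤ 1
  χ≤1 (yes _) = ≤-refl
  χ≤1 (no _)  = z≤n

  χ-yes : (d : Dec P) → P → χ d ≡ 1
  χ-yes (yes _) p = refl
  χ-yes (no ¬p) p = contradiction p ¬p

  χ-no : (d : Dec P) → ¬ P → χ d ≡ 0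
  χ-no (yes p) ¬p = contradiction p ¬p
  χ-no (no _)  ¬p = refl

  χ>0 : (d : Dec P) → 0 < χ d → P
  χ>0 (yes p) _ = p

  χ≡0 : (d : Dec P) → χ d ≡ 0 → ¬ P
  χ≡0 (no ¬p) _ = ¬p

χ-mono : {P Q : Set} (d : Dec P) (e : Dec Q) → (P → Q) → χ d ≤ χ e
χ-mono (yes p) e h = ≤-reflexive (sym (χ-yes e (h p)))
χ-mono (no _)  e h = z≤n

χ-×-≤ : {P Q : Set} (d : Dec P) (e : Dec Q) → χ (d ×-dec e) ≤ χ d * χ e
χ-×-≤ (yes _) (yes _) = ≤-refl
χ-×-≤ (yes _) (no _)  = z≤n
χ-×-≤ (no _)  _       = z≤n

χ-⊎-≤ : {P Q R : Set} (d : Dec P) (e : Dec Q) (f : Dec R) → (P → Q ⊎ R) → χ d ≤ χ e + χ f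
χ-⊎-≤ (no _)  e f h = z≤n
χ-⊎-≤ (yes p) e f h with h p
... | inj₁ q = ≤-trans (≤-reflexive (sym (χ-yes e q))) (m≤m+n _ _)
... | inj₂ r = ≤-trans (≤-reflexive (sym (χ-yes f r))) (m≤n+m _ (χ e))

length-filter-∑ : {A : Set} {P : A → Set} (P? : ∀ x → Dec (P x)) (xs : List A) →
                  length (filter P? xs) ≡ ∑ xs (λ x → χ (P? x))
length-filter-∑ P? []       = refl
length-filter-∑ P? (x ∷ xs) with P? x
... | yes _ = cong suc (length-filter-∑ P? xs)
... | no _  = length-filter-∑ P? xs

lookup-injective : {A : Set} {xs : List A} → Unique xs → ∀ i j → lookup xs i ≡ lookup xs j → i ≡ j
lookup-injective (x∉ ∷ u) fz     fz     e = refl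
lookup-injective (x∉ ∷ u) fz     (fs j) e = contradiction e (LAll.lookup x∉ (∈-lookup j))
lookup-injective (x∉ ∷ u) (fs i) fz     e = contradiction (sym e) (LAll.lookup x∉ (∈-lookup i))
lookup-injective (x∉ ∷ u) (fs i) (fs j) e = cong fs (lookup-injective u i j e)

-- Finite types and counting over them.

record Enumeration (A : Set) : Set where
  infix 4 _≟_
  field
    elements : List A
    _≟_      : DecidableEquality A
    -- Multiplicity one, put as a sum of indicators: `≥ 1` says that every element is listed, `≤ 1`
    -- that none is repeated, and both are ready for use inside double counts.
    once     : ∀ x → ∑ elements (λ y → χ (x ≟ y)) ≡ 1

module _ {A : Set} (E : Enumeration A) where
  open Enumeration E

  term≤∑ : (f : A → ℕ) (x : A) → f x ≤ ∑ elements f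
  term≤∑ f x = begin
    f x                                       ≡⟨ sym (*-identityʳ (f x)) ⟩
    f x * 1                                   ≡⟨ cong (f x *_) (sym (once x)) ⟩
    f x * ∑ elements (λ y → χ (x ≟ y))        ≡⟨ sym (∑-*ˡ elements (f x) _) ⟩
    ∑ elements (λ y → f x * χ (x ≟ y))        ≤⟨ ∑-mono elements only-x ⟩
    ∑ elements f                              ∎
    where
    open ≤-Reasoning
    only-x : ∀ y → f x * χ (x ≟ y) ≤ f y
    only-x y with x ≟ y
    ... | yes refl = ≤-reflexive (*-identityʳ (f x))
    ... | no _     = ≤-trans (≤-reflexive (*-zeroʳ (f x))) z≤n

  -- The number of witnesses decides: if it is zero, every candidate is refuted; if it is positive,
  -- a witness can be extracted.
  exists? : {P : A → Set} → (∀ x → Dec (P x)) → Dec (∃ P)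
  exists? {P} P? with ∑ elements (λ x → χ (P? x)) in eq
  ... | zero  = no λ { (x , p) →
                  χ≡0 (P? x) (n≤0⇒n≡0 (≤-trans (term≤∑ (λ y → χ (P? y)) x) (≤-reflexive eq))) p }
  ... | suc _ with ∑-positive elements (λ x → χ (P? x)) (≤-trans (s≤s z≤n) (≤-reflexive (sym eq)))
  ...   | x , p = yes (x , χ>0 (P? x) p)

  χ≤∑ : {P : Set} {Q : A → Set} (d : Dec P) (Q? : ∀ x → Dec (Q x)) →
        (P → ∃ Q) → χ d ≤ ∑ elements (λ x → χ (Q? x))
  χ≤∑ (no _)  Q? h = z≤n
  χ≤∑ (yes p) Q? h with h p
  ... | x , q = ≤-trans (≤-reflexive (sym (χ-yes (Q? x) q))) (term≤∑ (λ y → χ (Q? y)) x)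

  -- Given one witness `x`, uniqueness bounds the indicator of `Q y` by that of `x ≡ y`, and these
  -- sum to 1. It serves for unique coefficients over an independent tuple and for the unique member
  -- with a given basis.
  ∑≤χ : {P : Set} {Q : A → Set} (d : Dec P) (Q? : ∀ x → Dec (Q x)) →
        (∀ x → Q x → P) → (∀ x y → Q x → Q y → x ≡ y) → ∑ elements (λ x → χ (Q? x)) ≤ χ d
  ∑≤χ d Q? h unique with exists? Q?
  ... | yes (x , q) = begin
    ∑ elements (λ y → χ (Q? y))   ≤⟨ ∑-mono elements (λ y → χ-mono (Q? y) (x ≟ y) (unique x y q)) ⟩
    ∑ elements (λ y → χ (x ≟ y))  ≡⟨ once x ⟩
    1                             ≡⟨ sym (χ-yes d (h x q)) ⟩
    χ d                           ∎
    where open ≤-Reasoning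
  ... | no ¬q = begin
    ∑ elements (λ y → χ (Q? y))   ≤⟨ ∑-≤ elements (λ y → ≤-reflexive (χ-no (Q? y) λ q → ¬q (y , q))) ⟩
    length elements * 0           ≡⟨ *-zeroʳ (length elements) ⟩
    0                             ≤⟨ z≤n ⟩
    χ d                           ∎
    where open ≤-Reasoning

fin : (N : ℕ) → Enumeration (Fin N)
fin N = record { elements = allFin N ; _≟_ = _≟ᶠ_ ; once = once N }
  where
  ∑-tabulate : ∀ {N} {B : Set} (g : Fin N → B) (f : B → ℕ) → ∑ (tabulate g) f ≡ ∑ (allFin N) (f ∘ g)
  ∑-tabulate {zero}  g f = refl
  ∑-tabulate {suc N} g f =
    cong (f (g fz) +_) (trans (∑-tabulate (g ∘ fs) f) (sym (∑-tabulate fs (f ∘ g))))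
  once : ∀ N (i : Fin N) → ∑ (allFin N) (λ j → χ (i ≟ᶠ j)) ≡ 1
  once (suc N) fz     = cong suc (trans (∑-tabulate {N} fs (λ j → χ (fz ≟ᶠ j)))
    (trans (∑-const (allFin N) 0) (*-zeroʳ (length (allFin N)))))
  once (suc N) (fs i) = trans (∑-tabulate {N} fs (λ j → χ (fs i ≟ᶠ j))) (once N i)

transport : {A B : Set} (f : A → B) (g : B → A) → (∀ b → f (g b) ≡ b) → (∀ a → g (f a) ≡ a) →
            Enumeration A → Enumeration B
transport f g fg gf E = record
  { elements = L.map f elements
  ; _≟_      = λ b b' → map′ (λ e → trans (sym (fg b)) (trans (cong f e) (fg b'))) (cong g) (g b ≟ g b')
  ; once     = λ b → trans (∑-map f elements _)
                 (trans (∑-cong elements λ a → cong (λ z → χ (g b ≟ z)) (gf a)) (once (g b)))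
  }
  where open Enumeration E

-- Tuples over a finite type, with sums over them as iterated sums.

tuples : {A : Set} (m : ℕ) → List A → List (Vec A m)
tuples zero    xs = [] ∷ []
tuples (suc m) xs = cartesianProductWith _∷_ xs (tuples m xs)

∑-tuples : {A : Set} (m : ℕ) (xs : List A) (f : Vec A (suc m) → ℕ) →
           ∑ (tuples (suc m) xs) f ≡ ∑ xs (λ x → ∑ (tuples m xs) (λ t → f (x ∷ t)))
∑-tuples m xs f = ∑-product _∷_ xs (tuples m xs) f

length≡∑ : {A : Set} (xs : List A) → length xs ≡ ∑ xs (λ _ → 1)
length≡∑ xs = sym (trans (∑-const xs 1) (*-identityʳ (length xs)))

length-tuples : {A : Set} (m : ℕ) (xs : List A) → length (tuples m xs) ≡ length xs ^ m
length-tuples zero    xs = refl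
length-tuples (suc m) xs = begin
  length (tuples (suc m) xs)                       ≡⟨ length≡∑ (tuples (suc m) xs) ⟩
  ∑ (tuples (suc m) xs) (λ _ → 1)                  ≡⟨ ∑-tuples m xs _ ⟩
  ∑ xs (λ _ → ∑ (tuples m xs) (λ _ → 1))           ≡⟨ ∑-const xs _ ⟩
  length xs * ∑ (tuples m xs) (λ _ → 1)            ≡⟨ cong (length xs *_) (sym (length≡∑ (tuples m xs))) ⟩
  length xs * length (tuples m xs)                 ≡⟨ cong (length xs *_) (length-tuples m xs) ⟩
  length xs * length xs ^ m                        ∎
  where open ≡-Reasoning

∑-tuples-++ : {A : Set} (m m' : ℕ) (xs : List A) (f : Vec A (m + m') → ℕ) →
              ∑ (tuples (m + m') xs) f ≡ ∑ (tuples m xs) (λ t → ∑ (tuples m' xs) (λ s → f (t ++ s)))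
∑-tuples-++ zero    m' xs f = sym (+-identityʳ _)
∑-tuples-++ (suc m) m' xs f = begin
  ∑ (tuples (suc m + m') xs) f
    ≡⟨ ∑-tuples (m + m') xs f ⟩
  ∑ xs (λ x → ∑ (tuples (m + m') xs) (λ t → f (x ∷ t)))
    ≡⟨ ∑-cong xs (λ x → ∑-tuples-++ m m' xs (λ t → f (x ∷ t))) ⟩
  ∑ xs (λ x → ∑ (tuples m xs) (λ t → ∑ (tuples m' xs) (λ s → f (x ∷ t ++ s))))
    ≡⟨ ∑-tuples m xs (λ t → ∑ (tuples m' xs) (λ s → f (t ++ s))) ⟨
  ∑ (tuples (suc m) xs) (λ t → ∑ (tuples m' xs) (λ s → f (t ++ s))) ∎
  where open ≡-Reasoning

tuplesOf : {A : Set} (m : ℕ) → Enumeration A → Enumeration (Vec A m)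
tuplesOf {A} m E = record { elements = tuples m elements ; _≟_ = ≡-dec _≟_ ; once = once' m }
  where
  open Enumeration E
  once' : ∀ m (t : Vec A m) → ∑ (tuples m elements) (λ s → χ (≡-dec _≟_ t s)) ≡ 1
  once' zero    [] = refl
  once' (suc m) (x ∷ t) = begin
    ∑ (tuples (suc m) elements) (λ s → χ (≡-dec _≟_ (x ∷ t) s))
      ≡⟨ ∑-tuples m elements _ ⟩
    ∑ elements (λ y → ∑ (tuples m elements) (λ s → χ (≡-dec _≟_ (x ∷ t) (y ∷ s))))
      ≡⟨ ∑-cong elements inner ⟩
    ∑ elements (λ y → χ (x ≟ y))
      ≡⟨ once x ⟩
    1 ∎
    where
    open ≡-Reasoning
    inner : ∀ y → ∑ (tuples m elements) (λ s → χ (≡-dec _≟_ (x ∷ t) (y ∷ s))) ≡ χ (x ≟ y)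
    inner y with x ≟ y
    ... | yes _ = trans (∑-cong (tuples m elements) λ s → refl) (once' m t)
    ... | no _  = trans (∑-const (tuples m elements) 0) (*-zeroʳ (length (tuples m elements)))

-- The union bound over six independent choices.

module UnionBound {A B : Set} (V : List A) (T : List B) where

  private
    e τ : ℕ
    e = length V
    τ = length T

  -- An unnormalised expectation over the random x, y, z, t, s, r; probabilities become counts,
  -- which avoids division.
  ∑₆ : (A → A → A → B → B → B → ℕ) → ℕ
  ∑₆ f = ∑ V λ x → ∑ V λ y → ∑ V λ z → ∑ T λ t → ∑ T λ s → ∑ T λ r → f x y z t s r

  ∑₆-+ : ∀ f g → ∑₆ (λ x y z t s r → f x y z t s r + g x y z t s r) ≡ ∑₆ f + ∑₆ g
  ∑₆-+ f g = add V λ x → add V λ y → add V λ z → add T λ t → add T λ s → add T λ r → refl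
    where
    add : {C : Set} (xs : List C) {F G H : C → ℕ} → (∀ x → H x ≡ F x + G x) → ∑ xs H ≡ ∑ xs F + ∑ xs G
    add xs h = trans (∑-cong xs h) (∑-+ xs _ _)

  ∑₆-< : ∀ f g → ∑₆ f < ∑₆ g → ∃ λ x → ∃ λ y → ∃ λ z → ∃ λ t → ∃ λ s → ∃ λ r → f x y z t s r < g x y z t s r
  ∑₆-< f g lt =
    let x , lt = ∑-< V _ _ lt
        y , lt = ∑-< V _ _ lt
        z , lt = ∑-< V _ _ lt
        t , lt = ∑-< T _ _ lt
        s , lt = ∑-< T _ _ lt
        r , lt = ∑-< T _ _ lt
    in x , y , z , t , s , r , lt

  private
    -- A record, so that unification reads off the factor c and the sum b.
    record Scaled (a c b : ℕ) : Set where
      constructor scaled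
      field scaling : a ≡ c * b
    open Scaled

    keep : {C : Set} (xs : List C) {c : ℕ} {F G : C → ℕ} →
           (∀ x → Scaled (F x) c (G x)) → Scaled (∑ xs F) c (∑ xs G)
    keep xs {c} h = scaled (trans (∑-cong xs (scaling ∘ h)) (∑-*ˡ xs c _))

    drop : {C : Set} (xs : List C) {c a : ℕ} {F : C → ℕ} →
           (∀ x → Scaled (F x) c a) → Scaled (∑ xs F) (length xs * c) a
    drop xs {c} {a} h =
      scaled (trans (∑-cong xs (scaling ∘ h)) (trans (∑-const xs (c * a)) (sym (*-assoc (length xs) c a))))

    unit : ∀ {a} → Scaled a 1 a
    unit = scaled (sym (*-identityˡ _))

  -- Each coordinate that the summand ignores is summed out by `drop` and contributes the length of
  -- its list; `keep` passes through the others. Here z, s and r give one `e` and two `τ`.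
  marginal-xyt : (f : A → A → B → ℕ) → ∑₆ (λ x y _ t _ _ → f x y t) ≡
                 e * (τ * (τ * 1)) * ∑ V (λ x → ∑ V (λ y → ∑ T (f x y)))
  marginal-xyt f = scaling $ keep V λ x → keep V λ y → drop V λ z → keep T λ t → drop T λ s → drop T λ r → unit

  marginal-yzs : (f : A → A → B → ℕ) → ∑₆ (λ _ y z _ s _ → f y z s) ≡
                 e * (τ * (τ * 1)) * ∑ V (λ y → ∑ V (λ z → ∑ T (f y z)))
  marginal-yzs f = scaling $ drop V λ x → keep V λ y → keep V λ z → drop T λ t → keep T λ s → drop T λ r → unit

  marginal-xzr : (f : A → A → B → ℕ) → ∑₆ (λ x _ z _ _ r → f x z r) ≡
                 e * (τ * (τ * 1)) * ∑ V (λ x → ∑ V (λ z → ∑ T (f x z)))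
  marginal-xzr f = scaling $ keep V λ x → drop V λ y → keep V λ z → drop T λ t → drop T λ s → keep T λ r → unit

  marginal-xyzts : (f : A → A → A → B → B → ℕ) → ∑₆ (λ x y z t s _ → f x y z t s) ≡
                   τ * 1 * ∑ V (λ x → ∑ V (λ y → ∑ V (λ z → ∑ T (λ t → ∑ T (f x y z t)))))
  marginal-xyzts f = scaling $ keep V λ x → keep V λ y → keep V λ z → keep T λ t → keep T λ s → drop T λ r → unit

  marginal-xyzr : (f : A → A → A → B → ℕ) → ∑₆ (λ x y z _ _ r → f x y z r) ≡
                  τ * (τ * 1) * ∑ V (λ x → ∑ V (λ y → ∑ V (λ z → ∑ T (f x y z))))
  marginal-xyzr f = scaling $ keep V λ x → keep V λ y → keep V λ z → drop T λ t → drop T λ s → keep T λ r → unit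

  ∑₆-1 : ∑₆ (λ _ _ _ _ _ _ → 1) ≡ e * (e * (e * (τ * (τ * (τ * 1))))) * 1
  ∑₆-1 = scaling $ drop V λ x → drop V λ y → drop V λ z → drop T λ t → drop T λ s → drop T λ r → unit

  -- Failure probabilities 1/4 + 1/4 + 1/4 + 1/16 + 1/16 + 1/16 < 1.
  union-bound : (b p : A → A → B → ℕ) (δ : A → A → A → B → B → ℕ) (δ' : A → A → A → B → ℕ) →
    0 < e → 0 < τ →
    4 * ∑ V (λ x → ∑ V (λ y → ∑ T (b x y))) ≤ e * (e * τ) →
    16 * ∑ V (λ x → ∑ V (λ y → ∑ T (p x y))) ≤ e * (e * τ) →
    16 * ∑ V (λ x → ∑ V (λ y → ∑ V (λ z → ∑ T (λ t → ∑ T (δ x y z t))))) ≤ e * (e * (e * (τ * τ))) →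
    16 * ∑ V (λ x → ∑ V (λ y → ∑ V (λ z → ∑ T (δ' x y z)))) ≤ e * (e * (e * τ)) →
    ∃ λ x → ∃ λ y → ∃ λ z → ∃ λ t → ∃ λ s → ∃ λ r →
      b x y t ≡ 0 × b y z s ≡ 0 × b x z r ≡ 0 × p x y t ≡ 0 × δ x y z t s ≡ 0 × δ' x y z r ≡ 0
  union-bound b p δ δ' e>0 τ>0 hb hp hδ hδ' =
    let x , y , z , t , s , r , lt = ∑₆-< f (λ _ _ _ _ _ _ → 1) small
        -- A natural number below 1 is 0, so all six failure terms vanish at the point found.
        zero₁ , rest₁ = split (n<1⇒n≡0 lt)
        zero₂ , rest₂ = split rest₁
        zero₃ , rest₃ = split rest₂
        zero₄ , rest₄ = split rest₃
        zero₅ , zero₆ = split rest₄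
    in x , y , z , t , s , r , zero₁ , zero₂ , zero₃ , zero₄ , zero₅ , zero₆
    where
    split : ∀ {a c} → a + c ≡ 0 → a ≡ 0 × c ≡ 0
    split {a} h = m+n≡0⇒m≡0 a h , m+n≡0⇒n≡0 a h
    f₁ f₂ f₃ f₄ f₅ f₆ f : A → A → A → B → B → B → ℕ
    f₁ x y z t s r = b x y t
    f₂ x y z t s r = b y z s
    f₃ x y z t s r = b x z r
    f₄ x y z t s r = p x y t
    f₅ x y z t s r = δ x y z t s
    f₆ x y z t s r = δ' x y z r
    f x y z t s r = b x y t + (b y z s + (b x z r + (p x y t + (δ x y z t s + δ' x y z r))))
    Σb = ∑ V (λ x → ∑ V (λ y → ∑ T (b x y)))
    Σp = ∑ V (λ x → ∑ V (λ y → ∑ T (p x y)))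
    Σδ = ∑ V (λ x → ∑ V (λ y → ∑ V (λ z → ∑ T (λ t → ∑ T (δ x y z t)))))
    Σδ' = ∑ V (λ x → ∑ V (λ y → ∑ V (λ z → ∑ T (δ' x y z))))
    total : ℕ
    total = e * (e * (e * (τ * (τ * (τ * 1))))) * 1
    ∑f : ∑₆ f ≡ e * (τ * (τ * 1)) * Σb + (e * (τ * (τ * 1)) * Σb + (e * (τ * (τ * 1)) * Σb +
               (e * (τ * (τ * 1)) * Σp + (τ * 1 * Σδ + τ * (τ * 1) * Σδ'))))
    ∑f =
      trans (∑₆-+ f₁ _) (cong₂ _+_ (marginal-xyt b)
      (trans (∑₆-+ f₂ _) (cong₂ _+_ (marginal-yzs b)
      (trans (∑₆-+ f₃ _) (cong₂ _+_ (marginal-xzr b)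
      (trans (∑₆-+ f₄ _) (cong₂ _+_ (marginal-xyt p)
      (trans (∑₆-+ f₅ f₆) (cong₂ _+_ (marginal-xyzts δ) (marginal-xyzr δ'))))))))))
    total>0 : 0 < total
    total>0 = *-mono-≤ (*-mono-≤ e>0 (*-mono-≤ e>0 (*-mono-≤ e>0 (*-mono-≤ τ>0 (*-mono-≤ τ>0 (*-mono-≤ τ>0 (≤-refl {1}))))))) (≤-refl {1})
    -- The terms are brought to the shapes `4 * β` and `16 * _` of the hypotheses. In sixteenths,
    -- the three `β` weigh 3 * 4 = 12 and the other terms 3, hence the 15 in `collect`.
    expand : ∀ e τ β π d d' → 16 * (e * (τ * (τ * 1)) * β + (e * (τ * (τ * 1)) * β + (e * (τ * (τ * 1)) * β +
               (e * (τ * (τ * 1)) * π + (τ * 1 * d + τ * (τ * 1) * d')))))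
             ≡ e * τ * τ * 12 * (4 * β) + (e * τ * τ * (16 * π) + (τ * (16 * d) + τ * τ * (16 * d')))
    expand = solve-∀
    collect : ∀ e τ → e * τ * τ * 12 * (e * (e * τ)) + (e * τ * τ * (e * (e * τ)) +
                      (τ * (e * (e * (e * (τ * τ)))) + τ * τ * (e * (e * (e * τ)))))
              ≡ 15 * (e * (e * (e * (τ * (τ * (τ * 1))))) * 1)
    collect = solve-∀
    small : ∑₆ f < ∑₆ (λ _ _ _ _ _ _ → 1)
    small = *-cancelˡ-< 16 _ _ (begin-strict
      16 * ∑₆ f
        ≡⟨ trans (cong (16 *_) ∑f) (expand e τ Σb Σp Σδ Σδ') ⟩
      e * τ * τ * 12 * (4 * Σb) + (e * τ * τ * (16 * Σp) + (τ * (16 * Σδ) + τ * τ * (16 * Σδ')))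
        ≤⟨ +-mono-≤ (*-monoʳ-≤ (e * τ * τ * 12) hb) (+-mono-≤ (*-monoʳ-≤ (e * τ * τ) hp)
             (+-mono-≤ (*-monoʳ-≤ τ hδ) (*-monoʳ-≤ (τ * τ) hδ'))) ⟩
      _
        ≡⟨ collect e τ ⟩
      15 * total
        <⟨ m<n+m (15 * total) total>0 ⟩
      16 * total
        ≡⟨ cong (16 *_) ∑₆-1 ⟨
      16 * ∑₆ (λ _ _ _ _ _ _ → 1) ∎)
      where open ≤-Reasoning

-- Products, powers and the size of the Gaussian binomial.

prodUpTo-cong : ∀ k {f g : ℕ → ℕ} → (∀ i → i < k → f i ≡ g i) → prodUpTo k f ≡ prodUpTo k g
prodUpTo-cong zero    h = refl
prodUpTo-cong (suc k) h = cong₂ _*_ (prodUpTo-cong k (λ i i<k → h i (m<n⇒m<1+n i<k))) (h k (n<1+n k))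

prodUpTo-* : ∀ k (f g : ℕ → ℕ) → prodUpTo k (λ i → f i * g i) ≡ prodUpTo k f * prodUpTo k g
prodUpTo-* zero    f g = refl
prodUpTo-* (suc k) f g =
  trans (cong (_* (f k * g k)) (prodUpTo-* k f g)) (interchange (prodUpTo k f) (prodUpTo k g) (f k) (g k))
  where
  interchange : ∀ a b c d → a * b * (c * d) ≡ a * c * (b * d)
  interchange = solve-∀

prodUpTo-head : ∀ k (f : ℕ → ℕ) → prodUpTo (suc k) f ≡ f 0 * prodUpTo k (λ i → f (suc i))
prodUpTo-head zero    f = *-comm 1 (f 0)
prodUpTo-head (suc k) f =
  trans (cong (_* f (suc k)) (prodUpTo-head k f)) (*-assoc (f 0) (prodUpTo k (f ∘ suc)) (f (suc k)))

prodUpTo-≤ : ∀ k {f : ℕ → ℕ} {c} → (∀ i → f i ≤ c) → prodUpTo k f ≤ c ^ k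
prodUpTo-≤ zero            h = ≤-refl
prodUpTo-≤ (suc k) {c = c} h =
  ≤-trans (*-mono-≤ (prodUpTo-≤ k h) (h k)) (≤-reflexive (*-comm (c ^ k) c))

prodUpTo-> : ∀ k {f : ℕ → ℕ} → (∀ i → i < k → 0 < f i) → 0 < prodUpTo k f
prodUpTo-> zero    h = z<s
prodUpTo-> (suc k) h = *-mono-≤ (prodUpTo-> k (λ i i<k → h i (m<n⇒m<1+n i<k))) (h k (n<1+n k))

-- The remainder is below `b`, so rounding down costs at most one further `b`; `CB-small` later
-- shows that this error is negligible.
/′-remainder : ∀ a b → 0 < b → a ≤ (a /′ b) * b + b
/′-remainder a (suc b) _ = begin
  a                                     ≡⟨ m≡m%n+[m/n]*n a (suc b) ⟩
  a % suc b + a / suc b * suc b         ≡⟨ +-comm (a % suc b) _ ⟩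
  a / suc b * suc b + a % suc b         ≤⟨ +-monoʳ-≤ (a / suc b * suc b) (<⇒≤ (m%n<n a (suc b))) ⟩
  a / suc b * suc b + suc b             ∎
  where open ≤-Reasoning

n≤2^n : ∀ n → n ≤ 2 ^ n
n≤2^n zero    = z≤n
n≤2^n (suc n) = ≤-trans (+-mono-≤ (m^n>0 2 n) (n≤2^n n))
                        (+-monoʳ-≤ (2 ^ n) (m≤m+n (2 ^ n) 0))

module PowerEstimates (q : ℕ) (q≥2 : 2 ≤ q) where

  private instance
    q≢0 : NonZero q
    q≢0 = >-nonZero (<-trans z<s q≥2)

  2^n≤q^n : ∀ n → 2 ^ n ≤ q ^ n
  2^n≤q^n n = ^-monoˡ-≤ n q≥2

  -- Four spare factors of `q ≥ 2` supply 16 = 2 ^ 4.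
  16*q^m≤q^n : ∀ m n → 4 + m ≤ n → 16 * q ^ m ≤ q ^ n
  16*q^m≤q^n m n h = begin
    16 * q ^ m        ≤⟨ *-monoˡ-≤ (q ^ m) (2^n≤q^n 4) ⟩
    q ^ 4 * q ^ m     ≡⟨ ^-distribˡ-+-* q 4 m ⟨
    q ^ (4 + m)       ≤⟨ ^-monoʳ-≤ q h ⟩
    q ^ n             ∎
    where open ≤-Reasoning

  -- The factor `16 * d` is absorbed by `q ^ (16 * d)`, hence by its `m`-th power as `m ≥ 1`; the
  -- exponents then add up to `(2 + m + 16 * d) * m ≤ n * m`.
  few-poor : ∀ n m d → 1 ≤ m → 2 + m + 16 * d ≤ n → 16 * (d * (q ^ (2 + m)) ^ m) ≤ (q ^ n) ^ m
  few-poor n m d m≥1 h = begin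
    16 * (d * (q ^ (2 + m)) ^ m)              ≡⟨ *-assoc 16 d _ ⟨
    16 * d * (q ^ (2 + m)) ^ m                ≤⟨ *-monoˡ-≤ ((q ^ (2 + m)) ^ m) (≤-trans (n≤2^n (16 * d)) (2^n≤q^n (16 * d))) ⟩
    q ^ (16 * d) * (q ^ (2 + m)) ^ m          ≡⟨ cong (_* (q ^ (2 + m)) ^ m) (^-identityʳ (q ^ (16 * d))) ⟨
    (q ^ (16 * d)) ^ 1 * (q ^ (2 + m)) ^ m    ≤⟨ *-monoˡ-≤ ((q ^ (2 + m)) ^ m) (^-monoʳ-≤ (q ^ (16 * d)) ⦃ m^n≢0 q (16 * d) ⦄ m≥1) ⟩
    (q ^ (16 * d)) ^ m * (q ^ (2 + m)) ^ m    ≡⟨ cong₂ _*_ (^-*-assoc q (16 * d) m) (^-*-assoc q (2 + m) m) ⟩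
    q ^ (16 * d * m) * q ^ ((2 + m) * m)      ≡⟨ ^-distribˡ-+-* q (16 * d * m) ((2 + m) * m) ⟨
    q ^ (16 * d * m + (2 + m) * m)            ≡⟨ cong (q ^_) (trans (sym (*-distribʳ-+ m (16 * d) (2 + m))) (cong (_* m) (+-comm (16 * d) (2 + m)))) ⟩
    q ^ ((2 + m + 16 * d) * m)                ≤⟨ ^-monoʳ-≤ q (*-monoˡ-≤ m h) ⟩
    q ^ (n * m)                               ≡⟨ ^-*-assoc q n m ⟨
    (q ^ n) ^ m                               ∎
    where open ≤-Reasoning

  power-difference : ∀ a i → i ≤ a → q ^ suc a ∸ q ^ suc i ≡ q ^ suc i * (q ^ (a ∸ i) ∸ 1)
  power-difference a i i≤a = begin
    q ^ suc a ∸ q ^ suc i                         ≡⟨ cong (λ b → q ^ suc b ∸ q ^ suc i) (m+[n∸m]≡n i≤a) ⟨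
    q ^ (suc i + (a ∸ i)) ∸ q ^ suc i             ≡⟨ cong₂ _∸_ (^-distribˡ-+-* q (suc i) (a ∸ i)) (sym (*-identityʳ (q ^ suc i))) ⟩
    q ^ suc i * q ^ (a ∸ i) ∸ q ^ suc i * 1       ≡⟨ *-distribˡ-∸ (q ^ suc i) (q ^ (a ∸ i)) 1 ⟨
    q ^ suc i * (q ^ (a ∸ i) ∸ 1)                 ∎
    where open ≡-Reasoning

  -- For `a` = n - 1 the last product is the numerator of the Gaussian binomial (n - 1 over k - 1),
  -- for `a` = k - 1 its denominator. The same power of `q` is split off in both cases.
  product-of-differences : ∀ a k → k ≤ suc a → prodUpTo k (λ i → q ^ suc a ∸ q ^ suc i) ≡
    prodUpTo k (λ i → q ^ suc i) * prodUpTo k (λ i → q ^ (a ∸ i) ∸ 1)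
  product-of-differences a k k≤1+a = trans
    (prodUpTo-cong k (λ i i<k → power-difference a i (≤-pred (≤-trans i<k k≤1+a))))
    (prodUpTo-* k (λ i → q ^ suc i) (λ i → q ^ (a ∸ i) ∸ 1))

  -- The estimate that the product of the factors 1 - q^(i+1)/Q is at least 1 - q^(m+1)/Q, with
  -- denominators cleared. Each new factor at most doubles the error, and `2 ≤ q` turns the doubling
  -- into the next power of `q`.
  product-lower : ∀ Q m → Q * Q ^ m ≤ Q * prodUpTo m (λ i → Q ∸ q ^ suc i) + q ^ suc m * Q ^ m
  product-lower Q zero    = m≤m+n (Q * 1) _
  product-lower Q (suc m) = begin
    Q * (Q * Q ^ m)
      ≤⟨ *-monoʳ-≤ Q (product-lower Q m) ⟩
    Q * (Q * P + q ^ suc m * Q ^ m)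
      ≤⟨ *-monoʳ-≤ Q (+-monoˡ-≤ _ (≤-trans (*-monoˡ-≤ P (m≤n+m∸n Q (q ^ suc m))) (≤-reflexive (*-distribʳ-+ P (q ^ suc m) _)))) ⟩
    Q * (q ^ suc m * P + (Q ∸ q ^ suc m) * P + q ^ suc m * Q ^ m)
      ≤⟨ *-monoʳ-≤ Q (+-monoˡ-≤ _ (+-monoˡ-≤ _ (*-monoʳ-≤ (q ^ suc m) (prodUpTo-≤ m (λ i → m∸n≤m Q (q ^ suc i)))))) ⟩
    Q * (q ^ suc m * Q ^ m + (Q ∸ q ^ suc m) * P + q ^ suc m * Q ^ m)
      ≡⟨ rearrange Q (q ^ suc m) (Q ^ m) (Q ∸ q ^ suc m) P ⟩
    Q * (P * (Q ∸ q ^ suc m)) + 2 * (q ^ suc m * (Q * Q ^ m))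
      ≤⟨ +-monoʳ-≤ _ (≤-trans (*-monoˡ-≤ _ q≥2) (≤-reflexive (sym (*-assoc q (q ^ suc m) _)))) ⟩
    Q * (P * (Q ∸ q ^ suc m)) + q ^ suc (suc m) * (Q * Q ^ m) ∎
    where
    open ≤-Reasoning
    P = prodUpTo m (λ i → Q ∸ q ^ suc i)
    rearrange : ∀ Q a b c P → Q * (a * b + c * P + a * b) ≡ Q * (P * c) + 2 * (a * (Q * b))
    rearrange = solve-∀

  -- A family above the bound occupies at least (15/16)(15/16 − 1/16) ≥ 3/4 of all k-tuples.
  dense : ∀ n m N → 2 ≤ m → 6 + m ≤ n → q ^ (n ∸ (2 + m)) * gauss q (n ∸ 1) (1 + m) < N →
          3 * (q ^ n) ^ (2 + m) ≤ 4 * (N * prodUpTo (2 + m) (λ i → q ^ (2 + m) ∸ q ^ i))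
  dense (suc n) m N m≥2 (s≤s 5+m≤n) large = *-cancelˡ-≤ 64 (begin
    -- 192 is rounded up to 210 = 14 * 15. The 15 is spent on `Y-large`; 14 is 15 - 1, since
    -- `combined` gives up one part to the rounding error of the quotient.
    64 * (3 * (Q * Q ^ k'))           ≤⟨ ≤-trans (m≤m+n _ (18 * (Q * Q ^ k'))) (≤-reflexive (split₁ Q (Q ^ k'))) ⟩
    14 * (15 * Q * Q ^ k')            ≤⟨ *-monoʳ-≤ 14 (*-monoˡ-≤ (Q ^ k') Y-large) ⟩
    14 * (16 * Y * Q ^ k')            ≤⟨ +-cancelʳ-≤ (16 * (Y * Q ^ k')) _ _ combined ⟩
    256 * (N * P)                     ≡⟨ *-assoc 64 4 (N * P) ⟩
    64 * (4 * (N * P))                ∎)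
    where
    open ≤-Reasoning
    -- The ambient dimension is `suc n` and k is `suc k'`. `A` and `B` are the numerator and the
    -- denominator of `gauss`, `C` is the common power of `q`, and `P` is the number of ordered
    -- bases of a k-space.
    k' Q X Y A B C P : ℕ
    k' = suc m
    Q  = q ^ suc n
    X  = q ^ (n ∸ k')
    Y  = X * (q ^ suc k' ∸ 1)
    A  = prodUpTo k' (λ i → q ^ (n ∸ i) ∸ 1)
    B  = prodUpTo k' (λ i → q ^ (k' ∸ i) ∸ 1)
    C  = prodUpTo k' (λ i → q ^ suc i)
    P  = prodUpTo (suc k') (λ i → q ^ suc k' ∸ q ^ i)

    k'≤n : k' ≤ n
    k'≤n = ≤-trans (m≤n+m (suc m) 4) 5+m≤n

    split₁ : ∀ a b → 64 * (3 * (a * b)) + 18 * (a * b) ≡ 14 * (15 * a * b)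
    split₁ = solve-∀

    CB≡ : prodUpTo k' (λ i → q ^ suc k' ∸ q ^ suc i) ≡ C * B
    CB≡ = product-of-differences k' k' (n≤1+n k')

    CA≡ : prodUpTo k' (λ i → Q ∸ q ^ suc i) ≡ C * A
    CA≡ = product-of-differences n k' (m≤n⇒m≤1+n k'≤n)

    P≡ : P ≡ (q ^ suc k' ∸ 1) * (C * B)
    P≡ = trans (prodUpTo-head k' (λ i → q ^ suc k' ∸ q ^ i)) (cong ((q ^ suc k' ∸ 1) *_) CB≡)

    X+Y≡Q : X + Y ≡ Q
    X+Y≡Q = begin-equality
      X + X * (q ^ suc k' ∸ 1)          ≡⟨ cong (_+ Y) (*-identityʳ X) ⟨
      X * 1 + X * (q ^ suc k' ∸ 1)      ≡⟨ *-distribˡ-+ X 1 _ ⟨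
      X * (1 + (q ^ suc k' ∸ 1))        ≡⟨ cong (X *_) (m+[n∸m]≡n (m^n>0 q (suc k'))) ⟩
      X * q ^ suc k'                    ≡⟨ ^-distribˡ-+-* q (n ∸ k') (suc k') ⟨
      q ^ (n ∸ k' + suc k')             ≡⟨ cong (q ^_) (trans (+-suc (n ∸ k') k') (cong suc (m∸n+n≡m k'≤n))) ⟩
      Q                                 ∎

    -- `X` is `Q` divided by q^k, and k ≥ 4 makes this at most a sixteenth of `Q`.
    Y-large : 15 * Q ≤ 16 * Y
    Y-large = +-cancelˡ-≤ Q _ _ (begin
      Q + 15 * Q           ≡⟨ cong (16 *_) X+Y≡Q ⟨
      16 * (X + Y)         ≡⟨ *-distribˡ-+ 16 X Y ⟩
      16 * X + 16 * Y      ≤⟨ +-monoˡ-≤ (16 * Y) (16*q^m≤q^n (n ∸ k') (suc n) 4+[n∸k']≤1+n) ⟩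
      Q + 16 * Y           ∎)
      where
      4+[n∸k']≤1+n : 4 + (n ∸ k') ≤ suc n
      4+[n∸k']≤1+n = begin
        4 + (n ∸ k')         ≤⟨ +-monoˡ-≤ (n ∸ k') (s≤s (s≤s m≥2)) ⟩
        suc k' + (n ∸ k')    ≡⟨ cong suc (m+[n∸m]≡n k'≤n) ⟩
        suc n                ∎

    B>0 : 0 < B
    B>0 = prodUpTo-> k' (λ i i<k' → m<n⇒0<n∸m (^-monoʳ-< q q≥2 (m<n⇒0<n∸m i<k')))

    -- The assumed excess is multiplied by `P`, so that `N * P` counts the bases of all members;
    -- `/′-remainder` replaces the quotient by `A` at the cost of `Y * (C * B)`.
    counted : Y * (C * A) ≤ N * P + Y * (C * B)
    counted = begin
      Y * (C * A)
        ≤⟨ *-monoʳ-≤ Y (*-monoʳ-≤ C (/′-remainder A B B>0)) ⟩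
      Y * (C * ((A /′ B) * B + B))
        ≡⟨ rearrange X (q ^ suc k' ∸ 1) C (A /′ B) B ⟩
      X * (A /′ B) * ((q ^ suc k' ∸ 1) * (C * B)) + Y * (C * B)
        ≤⟨ +-monoˡ-≤ _ (*-mono-≤ (<⇒≤ large) (≤-reflexive (sym P≡))) ⟩
      N * P + Y * (C * B) ∎
      where
      rearrange : ∀ X a C g B → X * a * (C * (g * B + B)) ≡ X * g * (a * (C * B)) + X * a * (C * B)
      rearrange = solve-∀

    -- One of the `k'` factors, each at most q^k, yields the sixteenth, being small against `Q`; the
    -- others are just bounded by `Q`.
    CB-small : 16 * (C * B) ≤ Q ^ k'
    CB-small = begin
      16 * (C * B)                          ≡⟨ cong (16 *_) CB≡ ⟨
      16 * prodUpTo k' (λ i → q ^ suc k' ∸ q ^ suc i)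
        ≤⟨ *-monoʳ-≤ 16 (prodUpTo-≤ k' (λ i → m∸n≤m (q ^ suc k') (q ^ suc i))) ⟩
      16 * (q ^ suc k') ^ k'                ≡⟨ cong (16 *_) (*-comm (q ^ suc k') ((q ^ suc k') ^ m)) ⟩
      16 * ((q ^ suc k') ^ m * q ^ suc k')  ≡⟨ swap 16 ((q ^ suc k') ^ m) (q ^ suc k') ⟩
      16 * q ^ suc k' * (q ^ suc k') ^ m
        ≤⟨ *-mono-≤ 16q^k≤Q (^-monoˡ-≤ m (^-monoʳ-≤ q (s≤s k'≤n))) ⟩
      Q * Q ^ m                             ∎
      where
      swap : ∀ a b c → a * (b * c) ≡ a * c * b
      swap = solve-∀
      16q^k≤Q : 16 * q ^ suc k' ≤ Q
      16q^k≤Q = 16*q^m≤q^n (suc k') (suc n) (s≤s 5+m≤n)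

    CA-large : 15 * Q ^ k' ≤ 16 * (C * A)
    CA-large = *-cancelˡ-≤ Q ⦃ m^n≢0 q (suc n) ⦄ (+-cancelʳ-≤ (Q * Q ^ k') _ _ (begin
      Q * (15 * Q ^ k') + Q * Q ^ k'                    ≡⟨ split₂ Q (Q ^ k') ⟩
      16 * (Q * Q ^ k')                                 ≤⟨ *-monoʳ-≤ 16 (product-lower Q k') ⟩
      16 * (Q * prodUpTo k' (λ i → Q ∸ q ^ suc i) + q ^ suc k' * Q ^ k')
                                                        ≡⟨ cong (λ z → 16 * (Q * z + q ^ suc k' * Q ^ k')) CA≡ ⟩
      16 * (Q * (C * A) + q ^ suc k' * Q ^ k')          ≡⟨ split₃ Q (C * A) (q ^ suc k') (Q ^ k') ⟩
      Q * (16 * (C * A)) + 16 * q ^ suc k' * Q ^ k'     ≤⟨ +-monoʳ-≤ (Q * (16 * (C * A))) (*-monoˡ-≤ (Q ^ k') (16*q^m≤q^n (suc k') (suc n) (s≤s 5+m≤n))) ⟩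
      Q * (16 * (C * A)) + Q * Q ^ k'                   ∎))
      where
      split₂ : ∀ a b → a * (15 * b) + a * b ≡ 16 * (a * b)
      split₂ = solve-∀
      split₃ : ∀ a b c d → 16 * (a * b + c * d) ≡ a * (16 * b) + 16 * c * d
      split₃ = solve-∀

    combined : 14 * (16 * Y * Q ^ k') + 16 * (Y * Q ^ k') ≤ 256 * (N * P) + 16 * (Y * Q ^ k')
    combined = begin
      14 * (16 * Y * Q ^ k') + 16 * (Y * Q ^ k')    ≡⟨ split₄ Y (Q ^ k') ⟩
      16 * Y * (15 * Q ^ k')                        ≤⟨ *-monoʳ-≤ (16 * Y) CA-large ⟩
      16 * Y * (16 * (C * A))                       ≡⟨ split₅ Y (C * A) ⟩
      256 * (Y * (C * A))                           ≤⟨ *-monoʳ-≤ 256 counted ⟩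
      256 * (N * P + Y * (C * B))                   ≡⟨ split₆ (N * P) Y (C * B) ⟩
      256 * (N * P) + 16 * (Y * (16 * (C * B)))     ≤⟨ +-monoʳ-≤ (256 * (N * P)) (*-monoʳ-≤ 16 (*-monoʳ-≤ Y CB-small)) ⟩
      256 * (N * P) + 16 * (Y * Q ^ k')             ∎
      where
      split₄ : ∀ a b → 14 * (16 * a * b) + 16 * (a * b) ≡ 16 * a * (15 * b)
      split₄ = solve-∀
      split₅ : ∀ a b → 16 * a * (16 * b) ≡ 256 * (a * b)
      split₅ = solve-∀
      split₆ : ∀ a b c → 256 * (a + b * c) ≡ 256 * a + 16 * (b * (16 * c))
      split₆ = solve-∀

-- Linear algebra over a finite field.

module LinearAlgebra (F : FiniteField) where
  open FiniteField F using (Carrier; 0#; 1#; -_; isCommutativeRing; 1≢0; inverse; card; enum)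
    renaming (_+_ to _+ᶠ_; _*_ to _*ᶠ_)
  open IsCommutativeRing isCommutativeRing using ()
    renaming (+-assoc to +ᶠ-assoc; +-comm to +ᶠ-comm; +-identityˡ to +ᶠ-identityˡ; +-identityʳ to +ᶠ-identityʳ;
              *-assoc to *ᶠ-assoc; *-comm to *ᶠ-comm; *-identityˡ to *ᶠ-identityˡ; distribˡ to *ᶠ-distribˡ;
              distribʳ to *ᶠ-distribʳ; zeroˡ to *ᶠ-zeroˡ; zeroʳ to *ᶠ-zeroʳ; -‿inverseʳ to -ᶠ-inverseʳ)

  infixl 6 _+ᵥ_
  infixr 7 _·_

  𝟎 : ∀ {n} → Vec Carrier n
  𝟎 = zeroVec F

  _+ᵥ_ : ∀ {n} → Vec Carrier n → Vec Carrier n → Vec Carrier n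
  _+ᵥ_ = _⊕_ F

  _·_ : ∀ {n} → Carrier → Vec Carrier n → Vec Carrier n
  _·_ = _⊙_ F

  +ᵥ-assoc : ∀ {n} (u v w : Vec Carrier n) → (u +ᵥ v) +ᵥ w ≡ u +ᵥ (v +ᵥ w)
  +ᵥ-assoc = zipWith-assoc +ᶠ-assoc

  +ᵥ-comm : ∀ {n} (u v : Vec Carrier n) → u +ᵥ v ≡ v +ᵥ u
  +ᵥ-comm = zipWith-comm +ᶠ-comm

  +ᵥ-identityˡ : ∀ {n} (u : Vec Carrier n) → 𝟎 +ᵥ u ≡ u
  +ᵥ-identityˡ = zipWith-identityˡ +ᶠ-identityˡ

  +ᵥ-identityʳ : ∀ {n} (u : Vec Carrier n) → u +ᵥ 𝟎 ≡ u
  +ᵥ-identityʳ = zipWith-identityʳ +ᶠ-identityʳ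

  ·-distribˡ : ∀ {n} a (u v : Vec Carrier n) → a · (u +ᵥ v) ≡ a · u +ᵥ a · v
  ·-distribˡ a []      []      = refl
  ·-distribˡ a (x ∷ u) (y ∷ v) = cong₂ _∷_ (*ᶠ-distribˡ a x y) (·-distribˡ a u v)

  ·-distribʳ : ∀ {n} a b (u : Vec Carrier n) → (a +ᶠ b) · u ≡ a · u +ᵥ b · u
  ·-distribʳ a b []      = refl
  ·-distribʳ a b (x ∷ u) = cong₂ _∷_ (*ᶠ-distribʳ x a b) (·-distribʳ a b u)

  ·-assoc : ∀ {n} a b (u : Vec Carrier n) → (a *ᶠ b) · u ≡ a · b · u
  ·-assoc a b []      = refl
  ·-assoc a b (x ∷ u) = cong₂ _∷_ (*ᶠ-assoc a b x) (·-assoc a b u)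

  ·-identity : ∀ {n} (u : Vec Carrier n) → 1# · u ≡ u
  ·-identity []      = refl
  ·-identity (x ∷ u) = cong₂ _∷_ (*ᶠ-identityˡ x) (·-identity u)

  ·-zeroˡ : ∀ {n} (u : Vec Carrier n) → 0# · u ≡ 𝟎
  ·-zeroˡ []      = refl
  ·-zeroˡ (x ∷ u) = cong₂ _∷_ (*ᶠ-zeroˡ x) (·-zeroˡ u)

  ·-zeroʳ : ∀ {n} a → a · 𝟎 {n} ≡ 𝟎
  ·-zeroʳ {zero}  a = refl
  ·-zeroʳ {suc n} a = cong₂ _∷_ (*ᶠ-zeroʳ a) (·-zeroʳ a)

  ·-inverseʳ : ∀ {n} (u : Vec Carrier n) → u +ᵥ (- 1#) · u ≡ 𝟎
  ·-inverseʳ u = begin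
    u +ᵥ (- 1#) · u           ≡⟨ cong (_+ᵥ (- 1#) · u) (·-identity u) ⟨
    1# · u +ᵥ (- 1#) · u      ≡⟨ ·-distribʳ 1# (- 1#) u ⟨
    (1# +ᶠ - 1#) · u          ≡⟨ cong (_· u) (-ᶠ-inverseʳ 1#) ⟩
    0# · u                    ≡⟨ ·-zeroˡ u ⟩
    𝟎                         ∎
    where open ≡-Reasoning

  difference-zero : ∀ {n} (u v : Vec Carrier n) → u +ᵥ (- 1#) · v ≡ 𝟎 → u ≡ v
  difference-zero u v e = begin
    u                               ≡⟨ +ᵥ-identityʳ u ⟨
    u +ᵥ 𝟎                          ≡⟨ cong (u +ᵥ_) (trans (+ᵥ-comm _ v) (·-inverseʳ v)) ⟨
    u +ᵥ ((- 1#) · v +ᵥ v)          ≡⟨ +ᵥ-assoc u _ v ⟨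
    u +ᵥ (- 1#) · v +ᵥ v            ≡⟨ cong (_+ᵥ v) e ⟩
    𝟎 +ᵥ v                          ≡⟨ +ᵥ-identityˡ v ⟩
    v                               ∎
    where open ≡-Reasoning

  sum-zero : ∀ {n} (u v : Vec Carrier n) → u +ᵥ v ≡ 𝟎 → u ≡ (- 1#) · v
  sum-zero u v e = begin
    u                               ≡⟨ +ᵥ-identityʳ u ⟨
    u +ᵥ 𝟎                          ≡⟨ cong (u +ᵥ_) (·-inverseʳ v) ⟨
    u +ᵥ (v +ᵥ (- 1#) · v)          ≡⟨ +ᵥ-assoc u v _ ⟨
    u +ᵥ v +ᵥ (- 1#) · v            ≡⟨ cong (_+ᵥ (- 1#) · v) e ⟩
    𝟎 +ᵥ (- 1#) · v                 ≡⟨ +ᵥ-identityˡ _ ⟩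
    (- 1#) · v                      ∎
    where open ≡-Reasoning

  -- Counterpart of `lincomb` with coefficients and vectors stored as data: unlike functions, these
  -- have decidable equality and can be enumerated.
  lc : ∀ {n m} → Vec Carrier m → Vec (Vec Carrier n) m → Vec Carrier n
  lc []      []      = 𝟎
  lc (c ∷ a) (v ∷ t) = c · v +ᵥ lc a t

  lincomb≡lc : ∀ {n m} (c : Fin m → Carrier) (b : Fin m → Vec Carrier n) →
               lincomb F c b ≡ lc (vtabulate c) (vtabulate b)
  lincomb≡lc {m = zero}  c b = refl
  lincomb≡lc {m = suc m} c b = cong (c fz · b fz +ᵥ_) (lincomb≡lc (c ∘ fs) (b ∘ fs))

  private
    interchange : ∀ {n} (a b c d : Vec Carrier n) → (a +ᵥ b) +ᵥ (c +ᵥ d) ≡ (a +ᵥ c) +ᵥ (b +ᵥ d)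
    interchange a b c d = begin
      (a +ᵥ b) +ᵥ (c +ᵥ d)   ≡⟨ +ᵥ-assoc a b _ ⟩
      a +ᵥ (b +ᵥ (c +ᵥ d))   ≡⟨ cong (a +ᵥ_) (+ᵥ-assoc b c d) ⟨
      a +ᵥ (b +ᵥ c +ᵥ d)     ≡⟨ cong (λ z → a +ᵥ (z +ᵥ d)) (+ᵥ-comm b c) ⟩
      a +ᵥ (c +ᵥ b +ᵥ d)     ≡⟨ cong (a +ᵥ_) (+ᵥ-assoc c b d) ⟩
      a +ᵥ (c +ᵥ (b +ᵥ d))   ≡⟨ +ᵥ-assoc a c _ ⟨
      (a +ᵥ c) +ᵥ (b +ᵥ d)   ∎
      where open ≡-Reasoning

  lc-+ : ∀ {n m} (a b : Vec Carrier m) (t : Vec (Vec Carrier n) m) → lc (a +ᵥ b) t ≡ lc a t +ᵥ lc b t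
  lc-+ []      []      []      = sym (+ᵥ-identityˡ 𝟎)
  lc-+ (c ∷ a) (d ∷ b) (v ∷ t) =
    trans (cong₂ _+ᵥ_ (·-distribʳ c d v) (lc-+ a b t)) (interchange (c · v) (d · v) (lc a t) (lc b t))

  lc-· : ∀ {n m} e (a : Vec Carrier m) (t : Vec (Vec Carrier n) m) → lc (e · a) t ≡ e · lc a t
  lc-· e []      []      = sym (·-zeroʳ e)
  lc-· e (c ∷ a) (v ∷ t) =
    trans (cong₂ _+ᵥ_ (·-assoc e c v) (lc-· e a t)) (sym (·-distribˡ e (c · v) (lc a t)))

  lc-𝟎 : ∀ {n m} (t : Vec (Vec Carrier n) m) → lc 𝟎 t ≡ 𝟎
  lc-𝟎 []      = refl
  lc-𝟎 (v ∷ t) = trans (cong₂ _+ᵥ_ (·-zeroˡ v) (lc-𝟎 t)) (+ᵥ-identityˡ 𝟎)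

  lc-++ : ∀ {n m l} (a : Vec Carrier m) (b : Vec Carrier l) (t : Vec (Vec Carrier n) m) (s : Vec (Vec Carrier n) l) →
          lc (a ++ b) (t ++ s) ≡ lc a t +ᵥ lc b s
  lc-++ []      b []      s = sym (+ᵥ-identityˡ (lc b s))
  lc-++ (c ∷ a) b (v ∷ t) s =
    trans (cong (c · v +ᵥ_) (lc-++ a b t s)) (sym (+ᵥ-assoc (c · v) (lc a t) (lc b s)))

  lc-skip : ∀ {n m} (a : Vec Carrier m) (v : Vec Carrier n) (t : Vec (Vec Carrier n) m) →
            lc (0# ∷ a) (v ∷ t) ≡ lc a t
  lc-skip a v t = trans (cong (_+ᵥ lc a t) (·-zeroˡ v)) (+ᵥ-identityˡ (lc a t))

  lc-head : ∀ {n m} (v : Vec Carrier n) (t : Vec (Vec Carrier n) m) → lc (1# ∷ 𝟎) (v ∷ t) ≡ v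
  lc-head v t = trans (cong₂ _+ᵥ_ (·-identity v) (lc-𝟎 t)) (+ᵥ-identityʳ v)

  Span : ∀ {n m} → Vec (Vec Carrier n) m → Vec Carrier n → Set
  Span t v = ∃ λ a → lc a t ≡ v

  Independent : ∀ {n m} → Vec (Vec Carrier n) m → Set
  Independent t = ∀ a → lc a t ≡ 𝟎 → a ≡ 𝟎

  lc-injective : ∀ {n m} (t : Vec (Vec Carrier n) m) → Independent t → ∀ a b → lc a t ≡ lc b t → a ≡ b
  lc-injective t ind a b e = difference-zero a b (ind _ (begin
    lc (a +ᵥ (- 1#) · b) t           ≡⟨ lc-+ a _ t ⟩
    lc a t +ᵥ lc ((- 1#) · b) t      ≡⟨ cong₂ _+ᵥ_ e (lc-· (- 1#) b t) ⟩
    lc b t +ᵥ (- 1#) · lc b t        ≡⟨ ·-inverseʳ (lc b t) ⟩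
    𝟎                                ∎))
    where open ≡-Reasoning

  independent-tail : ∀ {n m} {v : Vec Carrier n} {t : Vec (Vec Carrier n) m} → Independent (v ∷ t) → Independent t
  independent-tail {v = v} {t} ind a e = proj₂ (∷-injective (ind (0# ∷ a) (trans (lc-skip a v t) e)))

  independent-head : ∀ {n m} {v : Vec Carrier n} {t : Vec (Vec Carrier n) m} → Independent (v ∷ t) → v ≢ 𝟎
  independent-head {v = v} {t} ind e = 1≢0 (proj₁ (∷-injective (ind (1# ∷ 𝟎) (trans (lc-head v t) e))))

  scalars : Enumeration Carrier
  scalars = transport from to strictlyInverseʳ strictlyInverseˡ (fin card)
    where open Inverse enum

  open Enumeration scalars using () renaming (_≟_ to _≟ᶜ_; elements to 𝔽)

  coefficients : ∀ m → Enumeration (Vec Carrier m)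
  coefficients m = tuplesOf m scalars

  _≟ᵥ_ : ∀ {n} → DecidableEquality (Vec Carrier n)
  _≟ᵥ_ = ≡-dec _≟ᶜ_

  span? : ∀ {n m} (t : Vec (Vec Carrier n) m) v → Dec (Span t v)
  span? {m = m} t v = exists? (coefficients m) (λ a → lc a t ≟ᵥ v)

  -- The decidable, recursive form of Independent that the counts run along.
  Free : ∀ {n m} → Vec (Vec Carrier n) m → Set
  Free []      = ⊤
  Free (v ∷ t) = ¬ Span t v × Free t

  free? : ∀ {n m} (t : Vec (Vec Carrier n) m) → Dec (Free t)
  free? []      = yes tt
  free? (v ∷ t) = ¬? (span? t v) ×-dec free? t

  -- A relation with nonzero leading coefficient `c` can be divided by `c`, which would put the head
  -- into the span of the tail.
  free⇒independent : ∀ {n m} (t : Vec (Vec Carrier n) m) → Free t → Independent t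
  free⇒independent []      _           []      _ = refl
  free⇒independent (v ∷ t) (v∉t , ind) (c ∷ a) e with c ≟ᶜ 0#
  ... | yes refl = cong (0# ∷_) (free⇒independent t ind a (trans (sym (lc-skip a v t)) e))
  ... | no c≢0 with inverse c c≢0
  ...   | d , cd≡1 = ⊥-elim (v∉t ((- 1#) · d · a , (begin
    lc ((- 1#) · d · a) t     ≡⟨ trans (lc-· (- 1#) (d · a) t) (cong ((- 1#) ·_) (lc-· d a t)) ⟩
    (- 1#) · d · lc a t       ≡⟨ sum-zero v (d · lc a t) vanish ⟨
    v                         ∎)))
    where
    open ≡-Reasoning
    vanish : v +ᵥ d · lc a t ≡ 𝟎
    vanish = begin
      v +ᵥ d · lc a t              ≡⟨ cong (_+ᵥ d · lc a t) (·-identity v) ⟨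
      1# · v +ᵥ d · lc a t         ≡⟨ cong (λ z → z · v +ᵥ d · lc a t) (trans (*ᶠ-comm d c) cd≡1) ⟨
      (d *ᶠ c) · v +ᵥ d · lc a t   ≡⟨ cong (_+ᵥ d · lc a t) (·-assoc d c v) ⟩
      d · c · v +ᵥ d · lc a t      ≡⟨ ·-distribˡ d (c · v) (lc a t) ⟨
      d · (c · v +ᵥ lc a t)        ≡⟨ cong (d ·_) e ⟩
      d · 𝟎                        ≡⟨ ·-zeroʳ d ⟩
      𝟎                            ∎

  card≥2 : 2 ≤ card
  card≥2 = two-elements (to 1#) (to 0#)
    (λ e → 1≢0 (trans (sym (strictlyInverseʳ 1#)) (trans (cong from e) (strictlyInverseʳ 0#))))
    where
    open Inverse enum
    two-elements : ∀ {N} (i j : Fin N) → i ≢ j → 2 ≤ N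
    two-elements {suc (suc _)} _  _  _   = s≤s (s≤s z≤n)
    two-elements {suc zero}    fz fz i≢j = contradiction refl i≢j

  instance
    card≢0 : NonZero card
    card≢0 = >-nonZero (<-trans z<s card≥2)

  -- Counting vectors, spans and dependent tuples.

  vectors : ∀ n → List (Vec Carrier n)
  vectors n = Enumeration.elements (coefficients n)

  length-vectors : ∀ n → length (vectors n) ≡ card ^ n
  length-vectors n = trans (length-tuples n 𝔽)
    (cong (_^ n) (trans (length-map _ (allFin card)) (length-tabulate {n = card} (λ i → i))))

  -- Double count of the pairs `(a , v)` with `lc a t ≡ v`: every coefficient vector yields exactly
  -- one `v`.
  span-count-≤ : ∀ {n m} (t : Vec (Vec Carrier n) m) → ∑ (vectors n) (λ v → χ (span? t v)) ≤ card ^ m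
  span-count-≤ {n} {m} t = begin
    ∑ (vectors n) (λ v → χ (span? t v))
      ≤⟨ ∑-mono (vectors n) (λ v → χ≤∑ (coefficients m) (span? t v) (λ a → lc a t ≟ᵥ v) (λ s → s)) ⟩
    ∑ (vectors n) (λ v → ∑ (vectors m) (λ a → χ (lc a t ≟ᵥ v)))
      ≡⟨ ∑-swap (vectors n) (vectors m) _ ⟩
    ∑ (vectors m) (λ a → ∑ (vectors n) (λ v → χ (lc a t ≟ᵥ v)))
      ≡⟨ ∑-cong (vectors m) (λ a → Enumeration.once (coefficients n) (lc a t)) ⟩
    ∑ (vectors m) (λ _ → 1)
      ≡⟨ length≡∑ (vectors m) ⟨
    length (vectors m)
      ≡⟨ length-vectors m ⟩
    card ^ m ∎
    where open ≤-Reasoning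

  -- The same double count; independence leaves at most one `a` for each `v`.
  span-count-≥ : ∀ {n m} (t : Vec (Vec Carrier n) m) → Independent t →
                 card ^ m ≤ ∑ (vectors n) (λ v → χ (span? t v))
  span-count-≥ {n} {m} t ind = begin
    card ^ m
      ≡⟨ length-vectors m ⟨
    length (vectors m)
      ≡⟨ length≡∑ (vectors m) ⟩
    ∑ (vectors m) (λ _ → 1)
      ≡⟨ ∑-cong (vectors m) (λ a → Enumeration.once (coefficients n) (lc a t)) ⟨
    ∑ (vectors m) (λ a → ∑ (vectors n) (λ v → χ (lc a t ≟ᵥ v)))
      ≡⟨ ∑-swap (vectors m) (vectors n) _ ⟩
    ∑ (vectors n) (λ v → ∑ (vectors m) (λ a → χ (lc a t ≟ᵥ v)))
      ≤⟨ ∑-mono (vectors n) (λ v → ∑≤χ (coefficients m) (span? t v) (λ a → lc a t ≟ᵥ v) (λ a e → a , e)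
           (λ a b e e' → lc-injective t ind a b (trans e (sym e')))) ⟩
    ∑ (vectors n) (λ v → χ (span? t v)) ∎
    where open ≤-Reasoning

  -- Random m-tuples are dependent with probability at most q^m / q^n. Either the tail is already
  -- dependent, or the head is one of the at most q^m vectors in its span; the two errors add up to
  -- 2 q^m, at most q^(m+1).
  dependent-count : ∀ n m →
    card ^ n * ∑ (tuples m (vectors n)) (λ t → χ (¬? (free? t))) ≤ card ^ m * (card ^ n) ^ m
  dependent-count n zero    = ≤-trans (≤-reflexive (*-zeroʳ (card ^ n))) z≤n
  dependent-count n (suc m) = begin
    Q * ∑ (tuples (suc m) V) (λ t → χ (¬? (free? t)))
      ≡⟨ cong (Q *_) (∑-tuples m V _) ⟩
    Q * ∑ V (λ v → ∑ T (λ t → χ (¬? (free? (v ∷ t)))))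
      ≡⟨ cong (Q *_) (∑-swap V T _) ⟩
    Q * ∑ T (λ t → ∑ V (λ v → χ (¬? (free? (v ∷ t)))))
      ≤⟨ *-monoʳ-≤ Q (∑-mono T extend) ⟩
    Q * ∑ T (λ t → Q * χ (¬? (free? t)) + card ^ m)
      ≡⟨ cong (Q *_) (trans (∑-+ T _ _) (cong₂ _+_ (∑-*ˡ T Q _) (∑-const T (card ^ m)))) ⟩
    Q * (Q * D + length T * card ^ m)
      ≡⟨ cong (λ z → Q * (Q * D + z * card ^ m)) (trans (length-tuples m V) (cong (_^ m) (length-vectors n))) ⟩
    Q * (Q * D + Q ^ m * card ^ m)
      ≤⟨ *-monoʳ-≤ Q (+-monoˡ-≤ _ (dependent-count n m)) ⟩
    Q * (card ^ m * Q ^ m + Q ^ m * card ^ m)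
      ≡⟨ double Q (card ^ m) (Q ^ m) ⟩
    2 * (card ^ m * (Q * Q ^ m))
      ≤⟨ *-monoˡ-≤ _ card≥2 ⟩
    card * (card ^ m * (Q * Q ^ m))
      ≡⟨ *-assoc card (card ^ m) _ ⟨
    card ^ suc m * Q ^ suc m ∎
    where
    open ≤-Reasoning
    Q = card ^ n
    V = vectors n
    T = tuples m V
    D = ∑ T (λ t → χ (¬? (free? t)))
    double : ∀ a b c → a * (b * c + c * b) ≡ 2 * (b * (a * c))
    double = solve-∀
    extend : ∀ t → ∑ V (λ v → χ (¬? (free? (v ∷ t)))) ≤ Q * χ (¬? (free? t)) + card ^ m
    extend t with free? t
    ... | no ¬f = ≤-trans (∑-≤ V (λ v → χ≤1 (¬? (¬? (span? t v) ×-dec no ¬f))))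
                          (≤-trans (≤-reflexive (cong (_* 1) (length-vectors n))) (m≤m+n (Q * 1) _))
    ... | yes f = ≤-trans (∑-mono V (λ v → χ-mono (¬? (¬? (span? t v) ×-dec yes f)) (span? t v) (λ h → span v h (span? t v))))
                          (≤-trans (span-count-≤ t) (m≤n+m (card ^ m) (Q * 0)))
      where
      span : ∀ v → ¬ (¬ Span t v × Free t) → Dec (Span t v) → Span t v
      span v h (yes s) = s
      span v h (no ¬s) = ⊥-elim (h (¬s , f))

  -- Vectors and ordered bases of a subspace.

  module _ {n k : ℕ} (W : Subspace F n k) where

    In : Vec Carrier n → Set
    In v = mem W v ≡ true

    in? : ∀ v → Dec (In v)
    in? v = mem W v ≟ᵇ true

    basisTuple : Vec (Vec Carrier n) k
    basisTuple = vtabulate (basis W)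

    lincomb-basis : ∀ a → lincomb F (vlookup a) (basis W) ≡ lc a basisTuple
    lincomb-basis a = trans (lincomb≡lc (vlookup a) (basis W)) (cong (λ z → lc z basisTuple) (tabulate∘lookup a))

    in⇒span : ∀ {v} → In v → Span basisTuple v
    in⇒span {v} p with Equivalence.to (spans W v) p
    ... | c , e = vtabulate c , trans (sym (lincomb≡lc c (basis W))) e

    span⇒in : ∀ {v} → Span basisTuple v → In v
    span⇒in {v} (a , e) = Equivalence.from (spans W v) (vlookup a , trans (lincomb-basis a) e)

    basis-independent : Independent basisTuple
    basis-independent a e = all-zero a (indep W (vlookup a) (trans (lincomb-basis a) e))
      where
      all-zero : ∀ {m} (a : Vec Carrier m) → (∀ i → vlookup a i ≡ 0#) → a ≡ 𝟎
      all-zero []      h = refl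
      all-zero (c ∷ a) h = cong₂ _∷_ (h fz) (all-zero a (h ∘ fs))

    in-lc : ∀ {m} (a : Vec Carrier m) {t} → All In t → In (lc a t)
    in-lc []      []       = span⇒in (𝟎 , lc-𝟎 basisTuple)
    in-lc (c ∷ a) (p ∷ ps) with in⇒span p | in⇒span (in-lc a ps)
    ... | b , e | b' , e' = span⇒in (c · b +ᵥ b' ,
      trans (lc-+ (c · b) b' basisTuple) (cong₂ _+ᵥ_ (trans (lc-· c b basisTuple) (cong (c ·_) e)) e'))

    in-count-≤ : ∑ (vectors n) (λ v → χ (in? v)) ≤ card ^ k
    in-count-≤ = ≤-trans (∑-mono (vectors n) (λ v → χ-mono (in? v) (span? basisTuple v) in⇒span))
                         (span-count-≤ basisTuple)

    in-count-≥ : card ^ k ≤ ∑ (vectors n) (λ v → χ (in? v))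
    in-count-≥ = ≤-trans (span-count-≥ basisTuple basis-independent)
                         (∑-mono (vectors n) (λ v → χ-mono (span? basisTuple v) (in? v) span⇒in))

    -- Dimension by cardinality: a vector of `W` outside the span would extend `t` to an independent
    -- tuple spanning q^(k+1) vectors of `W`, which has at most q^k.
    free⇒spanning : (t : Vec (Vec Carrier n) k) → Free t → All In t → ∀ {v} → In v → Span t v
    free⇒spanning t free t⊆W {v} v∈W with span? t v
    ... | yes s = s
    ... | no ¬s = ⊥-elim (<⇒≱ (^-monoʳ-< card card≥2 (n<1+n k)) (begin
      card ^ suc k                                ≤⟨ span-count-≥ (v ∷ t) (free⇒independent (v ∷ t) (¬s , free)) ⟩
      ∑ (vectors n) (λ u → χ (span? (v ∷ t) u))   ≤⟨ ∑-mono (vectors n) (λ u → χ-mono (span? (v ∷ t) u) (in? u)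
                                                       λ { (a , e) → subst In e (in-lc a (v∈W ∷ t⊆W)) }) ⟩
      ∑ (vectors n) (λ u → χ (in? u))             ≤⟨ in-count-≤ ⟩
      card ^ k                                    ∎))
      where open ≤-Reasoning

    tuples-in-count-≤ : ∀ m → ∑ (tuples m (vectors n)) (λ t → χ (all? in? t)) ≤ (card ^ k) ^ m
    tuples-in-count-≤ zero    = ≤-refl
    tuples-in-count-≤ (suc m) = begin
      ∑ (tuples (suc m) V) (λ t → χ (all? in? t))
        ≡⟨ ∑-tuples m V _ ⟩
      ∑ V (λ v → ∑ T (λ t → χ (all? in? (v ∷ t))))
        ≤⟨ ∑-mono V (λ v → ∑-mono T (λ t → χ-×-≤ (in? v) (all? in? t))) ⟩
      ∑ V (λ v → ∑ T (λ t → χ (in? v) * χ (all? in? t)))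
        ≡⟨ ∑-cong V (λ v → trans (∑-*ˡ T (χ (in? v)) _) (*-comm (χ (in? v)) _)) ⟩
      ∑ V (λ v → ∑ T (λ t → χ (all? in? t)) * χ (in? v))
        ≡⟨ ∑-*ˡ V (∑ T (λ t → χ (all? in? t))) _ ⟩
      ∑ T (λ t → χ (all? in? t)) * ∑ V (λ v → χ (in? v))
        ≤⟨ *-mono-≤ (tuples-in-count-≤ m) in-count-≤ ⟩
      (card ^ k) ^ m * card ^ k
        ≡⟨ *-comm _ (card ^ k) ⟩
      (card ^ k) ^ suc m ∎
      where
      open ≤-Reasoning
      V = vectors n
      T = tuples m V

    -- Partial ordered bases of `W`; those of length `k` are the ordered bases.
    Frame : ∀ {m} → Vec (Vec Carrier n) m → Set
    Frame t = Free t × All In t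

    frame? : ∀ {m} (t : Vec (Vec Carrier n) m) → Dec (Frame t)
    frame? t = free? t ×-dec all? in? t

    -- Any vector of `W` outside the span of a frame of length m extends it, and at least q^k - q^m
    -- such vectors exist. At m = k the product is the order of GL_k.
    frame-count : ∀ m → prodUpTo m (λ i → card ^ k ∸ card ^ i) ≤ ∑ (tuples m (vectors n)) (λ t → χ (frame? t))
    frame-count zero    = ≤-refl
    frame-count (suc m) = begin
      prodUpTo m (λ i → card ^ k ∸ card ^ i) * (card ^ k ∸ card ^ m)
        ≤⟨ *-monoˡ-≤ _ (frame-count m) ⟩
      ∑ T (λ t → χ (frame? t)) * (card ^ k ∸ card ^ m)
        ≡⟨ trans (*-comm (∑ T (λ t → χ (frame? t))) _) (sym (∑-*ˡ T (card ^ k ∸ card ^ m) _)) ⟩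
      ∑ T (λ t → (card ^ k ∸ card ^ m) * χ (frame? t))
        ≤⟨ ∑-mono T extend ⟩
      ∑ T (λ t → ∑ V (λ v → χ (frame? (v ∷ t))))
        ≡⟨ ∑-swap T V _ ⟩
      ∑ V (λ v → ∑ T (λ t → χ (frame? (v ∷ t))))
        ≡⟨ ∑-tuples m V _ ⟨
      ∑ (tuples (suc m) V) (λ t → χ (frame? t)) ∎
      where
      open ≤-Reasoning
      V = vectors n
      T = tuples m V
      split : ∀ {t v} → Frame t → In v → Span t v ⊎ Frame (v ∷ t)
      split {t} {v} (free , t⊆W) v∈W with span? t v
      ... | yes s = inj₁ s
      ... | no ¬s = inj₂ ((¬s , free) , v∈W ∷ t⊆W)
      extend : ∀ t → (card ^ k ∸ card ^ m) * χ (frame? t) ≤ ∑ V (λ v → χ (frame? (v ∷ t)))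
      extend t = by-cases (frame? t)
        where
        by-cases : (d : Dec (Frame t)) → (card ^ k ∸ card ^ m) * χ d ≤ ∑ V (λ v → χ (frame? (v ∷ t)))
        by-cases (no _)  = ≤-trans (≤-reflexive (*-zeroʳ (card ^ k ∸ card ^ m))) z≤n
        by-cases (yes f) = ≤-trans (≤-reflexive (*-identityʳ _)) (m≤n+o⇒m∸n≤o (card ^ k) (card ^ m) (begin
          card ^ k
            ≤⟨ in-count-≥ ⟩
          ∑ V (λ v → χ (in? v))
            ≤⟨ ∑-mono V (λ v → χ-⊎-≤ (in? v) (span? t v) (frame? (v ∷ t)) (split f)) ⟩
          ∑ V (λ v → χ (span? t v) + χ (frame? (v ∷ t)))
            ≡⟨ ∑-+ V _ _ ⟩
          ∑ V (λ v → χ (span? t v)) + ∑ V (λ v → χ (frame? (v ∷ t)))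
            ≤⟨ +-monoˡ-≤ _ (span-count-≤ t) ⟩
          card ^ m + ∑ V (λ v → χ (frame? (v ∷ t))) ∎))

  -- Each of the two subspaces is spanned by `t` and contained in the other. This is what permits
  -- counting bases instead of members.
  frame-unique : ∀ {n k} (U W : Subspace F n k) (t : Vec (Vec Carrier n) k) →
                 Frame U t → Frame W t → SameSubspace F U W
  frame-unique U W t (free , t⊆U) (_ , t⊆W) v = equal (mem U v) (mem W v) refl refl
    where
    transfer : ∀ X Y → All (In X) t → All (In Y) t → mem X v ≡ true → mem Y v ≡ true
    transfer X Y t⊆X t⊆Y v∈X with free⇒spanning X t free t⊆X v∈X
    ... | a , e = subst (In Y) e (in-lc Y a t⊆Y)
    equal : ∀ b c → mem U v ≡ b → mem W v ≡ c → mem U v ≡ mem W v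
    equal true  _     p q = trans p (sym (transfer U W t⊆U t⊆W p))
    equal false true  p q = trans (transfer W U t⊆W t⊆U q) (sym q)
    equal false false p q = trans p (sym q)

  -- Three subspaces that meet only in zero.

  module Triangle {n m : ℕ} {x y z : Vec Carrier n} {t s r : Vec (Vec Carrier n) m}
    (W₁ W₂ W₃ : Subspace F n (2 + m))
    (frame₁ : Frame W₁ (x ∷ y ∷ t)) (frame₂ : Frame W₂ (y ∷ z ∷ s)) (frame₃ : Frame W₃ (x ∷ z ∷ r))
    (ind₁₂ : Independent (x ∷ y ∷ z ∷ t ++ s)) (ind₃ : Independent (x ∷ y ∷ z ∷ r)) where

    private
      X : Vec (Vec Carrier n) (3 + (m + m))
      X = x ∷ y ∷ z ∷ t ++ s
      Y : Vec (Vec Carrier n) (3 + m)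
      Y = x ∷ y ∷ z ∷ r

    -- Padding with zeros expresses vectors of `W₁` and `W₂` in one independent tuple `X`, where
    -- coefficients can be compared; `W₃` is treated likewise in `Y`. The unpadded form is kept to
    -- evaluate `v` once its coefficients are known.
    coordinates₁ : ∀ {v} → In W₁ v → ∃ λ a → ∃ λ b → ∃ λ c →
                   lc (a ∷ b ∷ c) (x ∷ y ∷ t) ≡ v × lc (a ∷ b ∷ 0# ∷ c ++ 𝟎) (x ∷ y ∷ z ∷ t ++ s) ≡ v
    coordinates₁ p with free⇒spanning W₁ _ (proj₁ frame₁) (proj₂ frame₁) p
    ... | a ∷ b ∷ c , e = a , b , c , e , trans (cong (λ w → a · x +ᵥ (b · y +ᵥ w)) (begin
      lc (0# ∷ c ++ 𝟎) (z ∷ t ++ s)   ≡⟨ lc-skip (c ++ 𝟎) z (t ++ s) ⟩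
      lc (c ++ 𝟎) (t ++ s)            ≡⟨ lc-++ c 𝟎 t s ⟩
      lc c t +ᵥ lc 𝟎 s                ≡⟨ cong (lc c t +ᵥ_) (lc-𝟎 s) ⟩
      lc c t +ᵥ 𝟎                     ≡⟨ +ᵥ-identityʳ (lc c t) ⟩
      lc c t                          ∎)) e
      where open ≡-Reasoning

    coordinates₂ : ∀ {v} → In W₂ v → ∃ λ a → ∃ λ b → ∃ λ c →
                   lc (0# ∷ a ∷ b ∷ 𝟎 {m} ++ c) (x ∷ y ∷ z ∷ t ++ s) ≡ v
    coordinates₂ p with free⇒spanning W₂ _ (proj₁ frame₂) (proj₂ frame₂) p
    ... | a ∷ b ∷ c , e = a , b , c , trans (lc-skip (a ∷ b ∷ 𝟎 {m} ++ c) x (y ∷ z ∷ t ++ s)) (trans (cong (λ w → a · y +ᵥ (b · z +ᵥ w)) (begin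
      lc (𝟎 {m} ++ c) (t ++ s)        ≡⟨ lc-++ 𝟎 c t s ⟩
      lc 𝟎 t +ᵥ lc c s                ≡⟨ cong (_+ᵥ lc c s) (lc-𝟎 t) ⟩
      𝟎 +ᵥ lc c s                     ≡⟨ +ᵥ-identityˡ (lc c s) ⟩
      lc c s                          ∎)) e)
      where open ≡-Reasoning

    coordinates₃ : ∀ {v} → In W₃ v → ∃ λ a → ∃ λ b → ∃ λ c →
                   lc (a ∷ 0# ∷ b ∷ c) (x ∷ y ∷ z ∷ r) ≡ v
    coordinates₃ p with free⇒spanning W₃ _ (proj₁ frame₃) (proj₂ frame₃) p
    ... | a ∷ b ∷ c , e = a , b , c , trans (cong (a · x +ᵥ_) (lc-skip (b ∷ c) y (z ∷ r))) e

    -- Over `X`, vectors of `W₂` have coefficient 0 at `x`, while `x` itself has 1. With `y∉W₃`,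
    -- this keeps the chosen members distinct.
    x∉W₂ : ¬ In W₂ x
    x∉W₂ p with coordinates₂ p
    ... | a , b , c , e = 1≢0 (proj₁ (∷-injective (lc-injective X ind₁₂ (1# ∷ 𝟎) (0# ∷ a ∷ b ∷ 𝟎 {m} ++ c)
      (trans (lc-head x (y ∷ z ∷ t ++ s)) (sym e)))))

    y∉W₃ : ¬ In W₃ y
    y∉W₃ p with coordinates₃ p
    ... | a , b , c , e = 1≢0 (proj₁ (∷-injective (proj₂ (∷-injective (lc-injective Y ind₃ (0# ∷ 1# ∷ 𝟎) (a ∷ 0# ∷ b ∷ c)
      (trans (trans (lc-skip (1# ∷ 𝟎) x (y ∷ z ∷ r)) (lc-head y (z ∷ r))) (sym e)))))))

    -- Comparison over `X` removes every coefficient of `v` except that of `y`; comparison over `Y`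
    -- removes this last one, as vectors of `W₃` have none there.
    trivial-intersection : ∀ v → In W₁ v → In W₂ v → In W₃ v → v ≡ 𝟎
    trivial-intersection v p₁ p₂ p₃ with coordinates₁ p₁ | coordinates₂ p₂ | coordinates₃ p₃
    ... | a , b , c , e , e₁ | a₂ , b₂ , c₂ , e₂ | a₃ , b₃ , c₃ , e₃ = trans v≡by (trans (cong (_· y) b≡0) (·-zeroˡ y))
      where
      open ≡-Reasoning
      same₁₂ = ∷-injective (lc-injective X ind₁₂ (a ∷ b ∷ 0# ∷ c ++ 𝟎) (0# ∷ a₂ ∷ b₂ ∷ 𝟎 {m} ++ c₂) (trans e₁ (sym e₂)))
      a≡0 : a ≡ 0#
      a≡0 = proj₁ same₁₂
      c≡0 : c ≡ 𝟎
      c≡0 = ++-injectiveˡ c 𝟎 (proj₂ (∷-injective (proj₂ (∷-injective (proj₂ same₁₂)))))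
      at-y : ∀ {l} (u : Vec (Vec Carrier n) l) → lc (0# ∷ b ∷ 𝟎) (x ∷ y ∷ u) ≡ b · y
      at-y u = trans (lc-skip (b ∷ 𝟎) x (y ∷ u)) (trans (cong (b · y +ᵥ_) (lc-𝟎 u)) (+ᵥ-identityʳ (b · y)))
      v≡by : v ≡ b · y
      v≡by = begin
        v                                   ≡⟨ e ⟨
        lc (a ∷ b ∷ c) (x ∷ y ∷ t)          ≡⟨ cong₂ (λ a c → lc (a ∷ b ∷ c) (x ∷ y ∷ t)) a≡0 c≡0 ⟩
        lc (0# ∷ b ∷ 𝟎) (x ∷ y ∷ t)         ≡⟨ at-y t ⟩
        b · y                               ∎
      b≡0 : b ≡ 0#
      b≡0 = proj₁ (∷-injective (proj₂ (∷-injective (lc-injective Y ind₃ (0# ∷ b ∷ 𝟎) (a₃ ∷ 0# ∷ b₃ ∷ c₃)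
        (trans (at-y (z ∷ r)) (trans (sym v≡by) (sym e₃)))))))

  -- Bases of members, pairs in many members, and the subfamily.

  module Family {n m : ℕ} (𝒱 : List (Subspace F n (2 + m))) (d : ℕ) where

    index : List (Fin (length 𝒱))
    index = allFin (length 𝒱)

    W : Fin (length 𝒱) → Subspace F n (2 + m)
    W = lookup 𝒱

    -- For distinct members, the indicator that `t` is a basis of some member. As a sum over members
    -- it allows the order of summation to be exchanged.
    weight : Vec (Vec Carrier n) (2 + m) → ℕ
    weight t = ∑ index (λ i → χ (frame? (W i) t))

    Both : (x y : Vec Carrier n) → Fin (length 𝒱) → Set
    Both x y i = In (W i) x × In (W i) y

    both? : ∀ x y i → Dec (Both x y i)
    both? x y i = in? (W i) x ×-dec in? (W i) y

    degree : (x y : Vec Carrier n) → ℕ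
    degree x y = ∑ index (λ i → χ (both? x y i))

    weight≤1 : Distinct F 𝒱 → ∀ t → weight t ≤ 1
    weight≤1 distinct t = ∑≤χ (fin (length 𝒱)) (yes tt) (λ i → frame? (W i) t) (λ _ _ → tt) unique
      where
      unique : ∀ i j → Frame (W i) t → Frame (W j) t → i ≡ j
      unique i j p q with i ≟ᶠ j
      ... | yes e = e
      ... | no ne = contradiction (frame-unique (W i) (W j) t p q) (distinct i j ne)

    weight-total : length 𝒱 * prodUpTo (2 + m) (λ i → card ^ (2 + m) ∸ card ^ i) ≤
                   ∑ (tuples (2 + m) (vectors n)) weight
    weight-total = begin
      length 𝒱 * p                                                              ≡⟨ cong (_* p) (length-tabulate {n = length 𝒱} (λ i → i)) ⟨
      length index * p                                                          ≤⟨ ∑-≥ index (λ i → frame-count (W i) (2 + m)) ⟩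
      ∑ index (λ i → ∑ (tuples (2 + m) (vectors n)) (λ t → χ (frame? (W i) t))) ≡⟨ ∑-swap index (tuples (2 + m) (vectors n)) _ ⟩
      ∑ (tuples (2 + m) (vectors n)) weight                                     ∎
      where
      open ≤-Reasoning
      p = prodUpTo (2 + m) (λ i → card ^ (2 + m) ∸ card ^ i)

    -- Marks bases of members whose first two vectors lie in at most `d` members, too few for the
    -- construction.
    poor : (x y : Vec Carrier n) (t : Vec (Vec Carrier n) m) → ℕ
    poor x y t = χ (degree x y ≤? d) * weight (x ∷ y ∷ t)

    -- At most `d` members contain both vectors, and in each of them `t` is one of at most (q^k)^m
    -- tuples of its vectors.
    poor-count : ∀ x y → ∑ (tuples m (vectors n)) (poor x y) ≤ d * (card ^ (2 + m)) ^ m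
    poor-count x y = ≤-trans (≤-reflexive (∑-*ˡ T (χ (degree x y ≤? d)) _)) (by-cases (degree x y ≤? d))
      where
      open ≤-Reasoning
      T = tuples m (vectors n)
      c = (card ^ (2 + m)) ^ m
      weaken : ∀ i t → χ (frame? (W i) (x ∷ y ∷ t)) ≤ χ (both? x y i) * χ (all? (in? (W i)) t)
      weaken i t = ≤-trans
        (χ-mono (frame? (W i) (x ∷ y ∷ t)) (both? x y i ×-dec all? (in? (W i)) t)
          λ { (_ , p ∷ q ∷ ps) → (p , q) , ps })
        (χ-×-≤ (both? x y i) (all? (in? (W i)) t))
      by-cases : (δ : Dec (degree x y ≤ d)) → χ δ * ∑ T (λ t → weight (x ∷ y ∷ t)) ≤ d * c
      by-cases (no _)  = z≤n
      by-cases (yes h) = begin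
        1 * ∑ T (λ t → weight (x ∷ y ∷ t))
          ≡⟨ *-identityˡ _ ⟩
        ∑ T (λ t → weight (x ∷ y ∷ t))
          ≡⟨ ∑-swap T index _ ⟩
        ∑ index (λ i → ∑ T (λ t → χ (frame? (W i) (x ∷ y ∷ t))))
          ≤⟨ ∑-mono index (λ i → ≤-trans (∑-mono T (weaken i)) (≤-reflexive (∑-*ˡ T (χ (both? x y i)) _))) ⟩
        ∑ index (λ i → χ (both? x y i) * ∑ T (λ t → χ (all? (in? (W i)) t)))
          ≤⟨ ∑-mono index (λ i → *-monoʳ-≤ (χ (both? x y i)) (tuples-in-count-≤ (W i) m)) ⟩
        ∑ index (λ i → χ (both? x y i) * c)
          ≡⟨ trans (∑-cong index (λ i → *-comm (χ (both? x y i)) c)) (∑-*ˡ index c _) ⟩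
        c * degree x y
          ≤⟨ *-monoʳ-≤ c h ⟩
        c * d
          ≡⟨ *-comm c d ⟩
        d * c ∎

    weight>0⇒frame : ∀ t → 0 < weight t → ∃ λ i → Frame (W i) t
    weight>0⇒frame t p with ∑-positive index (λ i → χ (frame? (W i) t)) p
    ... | i , q = i , χ>0 (frame? (W i) t) q

    nontrivial-subfamily : ∀ {x y z t s r} → 3 ≤ d →
      d < degree x y → 0 < weight (x ∷ y ∷ t) → 0 < weight (y ∷ z ∷ s) → 0 < weight (x ∷ z ∷ r) →
      Free (x ∷ y ∷ z ∷ t ++ s) → Free (x ∷ y ∷ z ∷ r) → HasNonTrivIntSubfamily F 𝒱 (d + 1)
    nontrivial-subfamily {x} {y} {z} {t} {s} {r} (s≤s (s≤s (s≤s {n = d'} z≤n))) rich w₁ w₂ w₃ free₁₂ free₃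
      with weight>0⇒frame (x ∷ y ∷ t) w₁ | weight>0⇒frame (y ∷ z ∷ s) w₂ | weight>0⇒frame (x ∷ z ∷ r) w₃
    ... | i₁ , frame₁@(_ , x∈₁ ∷ y∈₁ ∷ _) | i₂ , frame₂@(_ , y∈₂ ∷ z∈₂ ∷ _) | i₃ , frame₃@(_ , x∈₃ ∷ z∈₃ ∷ _) =
      (λ j → lookup members (inject≤ j enough)) ,
      (λ {j} {j'} e → inject≤-injective enough enough j j' (lookup-injective unique _ _ e)) ,
      (λ j j' _ → intersect (inject≤ j enough) (inject≤ j' enough)) ,
      -- Positions 2, 0 and 1 of `members` hold `i₁`, `i₂` and `i₃`; they exist because `3 ≤ d` was
      -- matched down to three successors.
      (λ v h → trivial-intersection v (h (fs (fs fz))) (h fz) (h (fs fz)))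
      where
      ind₁₂ = free⇒independent (x ∷ y ∷ z ∷ t ++ s) free₁₂
      ind₃ = free⇒independent (x ∷ y ∷ z ∷ r) free₃
      open Triangle (W i₁) (W i₂) (W i₃) frame₁ frame₂ frame₃ ind₁₂ ind₃

      x≢0 : x ≢ 𝟎
      x≢0 = independent-head ind₃
      y≢0 : y ≢ 𝟎
      y≢0 = independent-head (independent-tail ind₃)
      z≢0 : z ≢ 𝟎
      z≢0 = independent-head (independent-tail (independent-tail ind₃))

      other? : ∀ i → Dec (Both x y i × i₁ ≢ i)
      other? i = both? x y i ×-dec ¬? (i₁ ≟ᶠ i)

      -- The three members that meet trivially come first, so that `inject≤` keeps them when the
      -- list is cut to d + 1 entries. `others` omits `i₁` to avoid a repetition.
      others members : List (Fin (length 𝒱))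
      others  = filter other? index
      members = i₂ ∷ i₃ ∷ i₁ ∷ others

      both-rest : LAll.All (Both x y) (i₁ ∷ others)
      both-rest = (x∈₁ , y∈₁) LAll.∷ LAll.map proj₁ (all-filter other? index)

      both : ∀ j → Both x y (lookup (i₁ ∷ others) j)
      both j = LAll.lookup both-rest (∈-lookup j)

      degree-≤ : degree x y ≤ length others + 1
      degree-≤ = begin
        degree x y
          ≤⟨ ∑-mono index (λ i → χ-⊎-≤ (both? x y i) (other? i) (i₁ ≟ᶠ i) (λ b → split i b (i₁ ≟ᶠ i))) ⟩
        ∑ index (λ i → χ (other? i) + χ (i₁ ≟ᶠ i))
          ≡⟨ ∑-+ index _ _ ⟩
        ∑ index (λ i → χ (other? i)) + ∑ index (λ i → χ (i₁ ≟ᶠ i))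
          ≡⟨ cong₂ _+_ (sym (length-filter-∑ other? index)) (Enumeration.once (fin (length 𝒱)) i₁) ⟩
        length others + 1 ∎
        where
        open ≤-Reasoning
        split : ∀ i → Both x y i → Dec (i₁ ≡ i) → (Both x y i × i₁ ≢ i) ⊎ i₁ ≡ i
        split i b (yes e) = inj₂ e
        split i b (no ne) = inj₁ (b , ne)

      -- `i₁` and `others` already supply d + 1 entries, since the degree exceeds `d`; `i₂` and `i₃`
      -- are the surplus 2.
      enough : suc (suc (suc d')) + 1 ≤ length members
      enough = begin
        suc (suc (suc d')) + 1  ≡⟨ +-comm (suc (suc (suc d'))) 1 ⟩
        suc (suc (suc (suc d')))  ≤⟨ rich ⟩
        degree x y              ≤⟨ degree-≤ ⟩
        length others + 1       ≡⟨ +-comm (length others) 1 ⟩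
        1 + length others       ≤⟨ m≤n+m (1 + length others) 2 ⟩
        length members          ∎
        where open ≤-Reasoning

      unique : Unique members
      -- `x` separates `W₂` from all other entries, and `y` separates `W₃` from those through both
      -- `x` and `y`.
      unique = (i₂≢i₃ LAll.∷ LAll.map (λ b e → x∉W₂ (subst (λ i → In (W i) x) (sym e) (proj₁ b))) both-rest)
             ∷ LAll.map (λ b e → y∉W₃ (subst (λ i → In (W i) y) (sym e) (proj₂ b))) both-rest
             ∷ LAll.map proj₂ (all-filter other? index)
             ∷ filter⁺ other? (allFin⁺ (length 𝒱))
        where
        i₂≢i₃ : i₂ ≢ i₃
        i₂≢i₃ e = x∉W₂ (subst (λ i → In (W i) x) (sym e) x∈₃)

      intersect : ∀ a b → PosIntersect F (W (lookup members a)) (W (lookup members b))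
      intersect fz          fz          = y , y≢0 , y∈₂ , y∈₂
      intersect fz          (fs fz)     = z , z≢0 , z∈₂ , z∈₃
      intersect fz          (fs (fs b)) = y , y≢0 , y∈₂ , proj₂ (both b)
      intersect (fs fz)     fz          = z , z≢0 , z∈₃ , z∈₂
      intersect (fs fz)     (fs fz)     = x , x≢0 , x∈₃ , x∈₃
      intersect (fs fz)     (fs (fs b)) = x , x≢0 , x∈₃ , proj₁ (both b)
      intersect (fs (fs a)) fz          = y , y≢0 , proj₂ (both a) , y∈₂
      intersect (fs (fs a)) (fs fz)     = x , x≢0 , proj₁ (both a) , x∈₃
      intersect (fs (fs a)) (fs (fs b)) = x , x≢0 , proj₁ (both a) , proj₁ (both b)

    -- The three inequalities bound the failure events of the union bound: a missing basis, a poor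
    -- pair, and linear dependence.
    dense⇒nontrivial-subfamily : Distinct F 𝒱 → 3 ≤ d →
      3 * (card ^ n) ^ (2 + m) ≤ 4 * ∑ (tuples (2 + m) (vectors n)) weight →
      16 * (d * (card ^ (2 + m)) ^ m) ≤ (card ^ n) ^ m →
      16 * card ^ (3 + (m + m)) ≤ card ^ n →
      HasNonTrivIntSubfamily F 𝒱 (d + 1)
    dense⇒nontrivial-subfamily distinct d≥3 dense few-poor small =
      let x , y , z , t , s , r , b₁ , b₂ , b₃ , p , δ , δ' =
            union-bound miss poor dependent₅ dependent₄
              e>0 τ>0
              miss-bound poor-bound dependent₅-bound dependent₄-bound
          w₁ = m∸n≡0⇒m≤n {1} b₁
      in nontrivial-subfamily d≥3 (rich w₁ p) w₁ (m∸n≡0⇒m≤n {1} b₂) (m∸n≡0⇒m≤n {1} b₃)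
           (decided (free? (x ∷ y ∷ z ∷ t ++ s)) δ) (decided (free? (x ∷ y ∷ z ∷ r)) δ')
      where
      open ≤-Reasoning
      V = vectors n
      T = tuples m V
      Q e τ : ℕ
      Q = card ^ n
      e = length V
      τ = length T
      open UnionBound V T

      e≡Q : e ≡ Q
      e≡Q = length-vectors n

      e>0 : 0 < e
      e>0 = ≤-trans (m^n>0 card n) (≤-reflexive (sym e≡Q))

      τ≡Q^m : τ ≡ Q ^ m
      τ≡Q^m = trans (length-tuples m V) (cong (_^ m) e≡Q)

      τ>0 : 0 < τ
      τ>0 = ≤-trans (m^n>0 Q ⦃ m^n≢0 card n ⦄ m) (≤-reflexive (sym τ≡Q^m))

      -- As `weight` is at most 1, this is the indicator of failure, and its vanishing says that the
      -- weight is positive.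
      miss : Vec Carrier n → Vec Carrier n → Vec (Vec Carrier n) m → ℕ
      miss x y t = 1 ∸ weight (x ∷ y ∷ t)

      dependent₅ : (x y z : Vec Carrier n) (t s : Vec (Vec Carrier n) m) → ℕ
      dependent₅ x y z t s = χ (¬? (free? (x ∷ y ∷ z ∷ t ++ s)))

      dependent₄ : (x y z : Vec Carrier n) (r : Vec (Vec Carrier n) m) → ℕ
      dependent₄ x y z r = χ (¬? (free? (x ∷ y ∷ z ∷ r)))

      decided : ∀ {P : Set} (D : Dec P) → χ (¬? D) ≡ 0 → P
      decided (yes p) _ = p

      rich : ∀ {x y t} → 0 < weight (x ∷ y ∷ t) → poor x y t ≡ 0 → d < degree x y
      rich {x} {y} {t} w p with m*n≡0⇒m≡0∨n≡0 (χ (degree x y ≤? d)) p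
      ... | inj₁ c = ≰⇒> (χ≡0 (degree x y ≤? d) c)
      ... | inj₂ c = contradiction c (m<n⇒n≢0 w)

      -- `miss` and `weight` add up to 1 at every tuple, so a density of at least 3/4 leaves at most
      -- 1/4 for the failures.
      miss-bound : 4 * ∑ V (λ x → ∑ V (λ y → ∑ T (miss x y))) ≤ e * (e * τ)
      miss-bound = +-cancelʳ-≤ (4 * ∑w) _ _ (begin
        4 * ∑ V (λ x → ∑ V (λ y → ∑ T (miss x y))) + 4 * ∑w
          ≡⟨ cong (λ z → 4 * z + 4 * ∑w) pairs ⟨
        4 * ∑ (tuples (2 + m) V) (λ t → 1 ∸ weight t) + 4 * ∑w
          ≡⟨ *-distribˡ-+ 4 (∑ (tuples (2 + m) V) (λ t → 1 ∸ weight t)) ∑w ⟨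
        4 * (∑ (tuples (2 + m) V) (λ t → 1 ∸ weight t) + ∑w)
          ≡⟨ cong (4 *_) (trans (sym (∑-+ (tuples (2 + m) V) (λ t → 1 ∸ weight t) weight))
               (trans (∑-cong (tuples (2 + m) V) (λ t → m∸n+n≡m (weight≤1 distinct t)))
                 (trans (sym (length≡∑ (tuples (2 + m) V))) tuples-length))) ⟩
        4 * (e * (e * τ))
          ≡⟨ +-comm (e * (e * τ)) _ ⟩
        3 * (e * (e * τ)) + e * (e * τ)
          ≤⟨ +-monoˡ-≤ (e * (e * τ)) (≤-trans (≤-reflexive (cong (3 *_) (cong₂ _*_ e≡Q (cong₂ _*_ e≡Q τ≡Q^m)))) dense) ⟩
        4 * ∑w + e * (e * τ)
          ≡⟨ +-comm (4 * ∑w) _ ⟩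
        e * (e * τ) + 4 * ∑w ∎)
        where
        ∑w = ∑ (tuples (2 + m) V) weight
        tuples-length : length (tuples (2 + m) V) ≡ e * (e * τ)
        tuples-length = trans (length-tuples (2 + m) V) (cong (λ z → e * (e * z)) (sym (length-tuples m V)))
        pairs : ∑ (tuples (2 + m) V) (λ t → 1 ∸ weight t) ≡ ∑ V (λ x → ∑ V (λ y → ∑ T (miss x y)))
        pairs = trans (∑-tuples (1 + m) V _) (∑-cong V (λ x → ∑-tuples m V _))

      poor-bound : 16 * ∑ V (λ x → ∑ V (λ y → ∑ T (poor x y))) ≤ e * (e * τ)
      poor-bound = begin
        16 * ∑ V (λ x → ∑ V (λ y → ∑ T (poor x y)))
          ≤⟨ *-monoʳ-≤ 16 (∑-≤ V (λ x → ∑-≤ V (poor-count x))) ⟩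
        16 * (e * (e * c))
          ≡⟨ rearrange e c ⟩
        e * (e * (16 * c))
          ≤⟨ *-monoʳ-≤ e (*-monoʳ-≤ e (≤-trans few-poor (≤-reflexive (sym τ≡Q^m)))) ⟩
        e * (e * τ) ∎
        where
        c = d * (card ^ (2 + m)) ^ m
        rearrange : ∀ a b → 16 * (a * (a * b)) ≡ a * (a * (16 * b))
        rearrange = solve-∀

      dependent-rare : ∀ l → 16 * card ^ l ≤ Q → 16 * ∑ (tuples l V) (λ t → χ (¬? (free? t))) ≤ Q ^ l
      dependent-rare l h = *-cancelˡ-≤ Q ⦃ m^n≢0 card n ⦄ (begin
        Q * (16 * D)             ≡⟨ swap Q 16 D ⟩
        16 * (Q * D)             ≤⟨ *-monoʳ-≤ 16 (dependent-count n l) ⟩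
        16 * (card ^ l * Q ^ l)  ≡⟨ *-assoc 16 (card ^ l) _ ⟨
        16 * card ^ l * Q ^ l    ≤⟨ *-monoˡ-≤ (Q ^ l) h ⟩
        Q * Q ^ l                ∎)
        where
        D = ∑ (tuples l V) (λ t → χ (¬? (free? t)))
        swap : ∀ a b c → a * (b * c) ≡ b * (a * c)
        swap = solve-∀

      triples : ∀ {l} (f : Vec (Vec Carrier n) (3 + l) → ℕ) → ∑ (tuples (3 + l) V) f ≡
                ∑ V (λ x → ∑ V (λ y → ∑ V (λ z → ∑ (tuples l V) (λ t → f (x ∷ y ∷ z ∷ t)))))
      triples {l} f = trans (∑-tuples (2 + l) V _) (∑-cong V (λ x →
                      trans (∑-tuples (1 + l) V _) (∑-cong V (λ y → ∑-tuples l V _))))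

      dependent₅-bound : 16 * ∑ V (λ x → ∑ V (λ y → ∑ V (λ z → ∑ T (λ t → ∑ T (dependent₅ x y z t))))) ≤
                         e * (e * (e * (τ * τ)))
      dependent₅-bound = begin
        16 * ∑ V (λ x → ∑ V (λ y → ∑ V (λ z → ∑ T (λ t → ∑ T (dependent₅ x y z t)))))
          ≡⟨ cong (16 *_) (trans (triples {m + m} (λ t → χ (¬? (free? t)))) (∑-cong V (λ x → ∑-cong V (λ y → ∑-cong V (λ z →
               ∑-tuples-++ m m V (λ t → χ (¬? (free? (x ∷ y ∷ z ∷ t))))))))) ⟨
        16 * ∑ (tuples (3 + (m + m)) V) (λ t → χ (¬? (free? t)))
          ≤⟨ dependent-rare (3 + (m + m)) small ⟩
        Q * (Q * (Q * Q ^ (m + m)))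
          ≡⟨ cong₂ (λ a b → a * (a * (a * b))) (sym e≡Q)
               (trans (^-distribˡ-+-* Q m m) (cong₂ _*_ (sym τ≡Q^m) (sym τ≡Q^m))) ⟩
        e * (e * (e * (τ * τ))) ∎

      dependent₄-bound : 16 * ∑ V (λ x → ∑ V (λ y → ∑ V (λ z → ∑ T (dependent₄ x y z)))) ≤ e * (e * (e * τ))
      dependent₄-bound = begin
        16 * ∑ V (λ x → ∑ V (λ y → ∑ V (λ z → ∑ T (dependent₄ x y z))))
          ≡⟨ cong (16 *_) (triples {m} (λ t → χ (¬? (free? t)))) ⟨
        16 * ∑ (tuples (3 + m) V) (λ t → χ (¬? (free? t)))
          ≤⟨ dependent-rare (3 + m) (≤-trans (*-monoʳ-≤ 16 (^-monoʳ-≤ card (+-monoʳ-≤ 3 (m≤m+n m m)))) small) ⟩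
        Q * (Q * (Q * Q ^ m))
          ≡⟨ cong₂ (λ a b → a * (a * (a * b))) (sym e≡Q) (sym τ≡Q^m) ⟩
        e * (e * (e * τ)) ∎

theorem4p5 : (F : FiniteField) (d k : ℕ) → 4 ≤ k → k ≤ d →
    ∃ λ n₀ → ∀ n → n₀ ≤ n →
    (𝒱 : List (Subspace F n k)) → Distinct F 𝒱 →
    ¬ HasNonTrivIntSubfamily F 𝒱 (d + 1) →
    length 𝒱 ≤ FiniteField.card F ^ (n ∸ k) * gauss (FiniteField.card F) (n ∸ 1) (k ∸ 1)
theorem4p5 F d (suc (suc m)) (s≤s (s≤s m≥2)) k≤d =
  -- `7 + (m + m)` is 4 more than the length of (x,y,z,t,s), making its dependence rare; it also
  -- covers the `6 + m` of `dense`. The term `16 * d` is for `few-poor`.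
  7 + (m + m) + 16 * d , λ n n₀≤n 𝒱 distinct none →
    let open Family {n} {m} 𝒱 d
        n≥7+2m : 7 + (m + m) ≤ n
        n≥7+2m = ≤-trans (m≤m+n (7 + (m + m)) (16 * d)) n₀≤n
    in ≮⇒≥ λ large → none (dense⇒nontrivial-subfamily distinct
         (≤-trans (s≤s (s≤s (≤-trans (s≤s z≤n) m≥2))) k≤d)
         (≤-trans (dense n m (length 𝒱) m≥2 (≤-trans (+-mono-≤ (n≤1+n 6) (m≤m+n m m)) n≥7+2m) large)
                  (*-monoʳ-≤ 4 weight-total))
         (few-poor n m d (≤-trans (s≤s z≤n) m≥2)
           (≤-trans (+-monoˡ-≤ (16 * d) (+-mono-≤ (m≤m+n 2 5) (m≤m+n m m))) n₀≤n))
         (16*q^m≤q^n (3 + (m + m)) n n≥7+2m))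
  where
  open LinearAlgebra F
  open PowerEstimates (FiniteField.card F) card≥2
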